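{- Let $n,s,u$ be positive integers with $s\leq n$, and let $\mathcal{F} \subseteq \binom{[n]}{\leq u}$ be $(2,s)$-conditionally intersecting. (i) If $u \geq s - 1$ and $s = 2k$ for an integer $k$, then \[ |\mathcal{F}|\leq \binom{n-1}{k-1}+\sum_{i=k+1}^u\binom{n}{i}, \] and if $s < n$ also holds, then equality holds if and only if, up to isomorphism (i.e. up to a permutation of $[n]$), \[ \mathcal{F} = \{ F\in 2^{[n]} : k<|F|\leq u \} \cup \left\{ F\in \binom{[n]}{k} : 1\in F\right\}. \] (ii) If $u \geq s - 1$ and $s = 2k - 1$ for an integer $k$, then \[ |\mathcal{F}|\leq \sum_{i=k}^u \binom{n}{i}, \] and if $s < n$ also holds, then equality holds if and only if \[ \mathcal{F} = \{ F\in 2^{[n]} : k\leq |F|\leq u \}. \] (iii) If $u \leq \left\lfloor\frac{s}{2}\right\rfloor$, then \[ |\mathcal{F}| \leq \sum_{r=1}^{u}\binom{n-1}{r-1}, \] and equality holds if and only if, up to isomorphism, \[ \mathcal{F} = \{ F\in 2^{[n]} : 1\leq |F|\leq u \text{ and } 1\in F\}. \]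
   Context: $[n]=\{1,\ldots,n\}$, $2^{[n]}$ is its power set, $\binom{[n]}{k}$ is the family of all $k$-element subsets of $[n]$, and $\binom{[n]}{\leq u} = \{X\subseteq[n] : |X|\leq u\}$. A family $\mathcal{F} \subseteq 2^{[n]}$ is $(2,s)$-conditionally intersecting if, for each $A,B\in\mathcal{F}$ (not required to be distinct), $A \cap B \neq \emptyset$ whenever $|A \cup B| \leq s$. In particular, such a family does not contain the empty set. -}

module Defs where

open import Level using (0ℓ)
open import Data.Nat using (ℕ; suc; _+_; _∸_; _≤_; NonZero)
open import Data.Fin using (Fin; zero)
open import Data.Fin.Permutation using (Permutation′; _⟨$⟩ˡ_)
open import Data.Fin.Subset using (Subset; ∣_∣; _∪_; _∩_; Nonempty)
open import Data.List using (List; length; sum; applyUpTo)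
open import Data.List.Membership.Propositional using (_∈_)
open import Data.List.Relation.Unary.Unique.Propositional using (Unique)
open import Data.Product using (∃-syntax)
open import Data.Vec using (lookup; tabulate)
open import Relation.Unary using (Pred; _≐_)

-- The ground set [n] is Fin n, so the element 1 of [n] is zero.
first : ∀ n → .{{_ : NonZero n}} → Fin n
first (suc n) = zero

-- A family of subsets of [n] is finite: it is listed without repetition, so
-- that the length of the list is the cardinality.  The order of the list is
-- irrelevant; families are only ever compared through ⟦_⟧, extensionally.
record Family (n : ℕ) : Set where
  field
    members : List (Subset n)
    unique  : Unique members

⟦_⟧ : ∀ {n} → Family n → Pred (Subset n) 0ℓ
⟦ F ⟧ A = A ∈ Family.members F

card : ∀ {n} → Family n → ℕ
card F = length (Family.members F)

-- A and B may be equal, so for A = B = ∅ the condition fails.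
ConditionallyIntersecting : ∀ {n} → ℕ → Family n → Set
ConditionallyIntersecting s F =
  ∀ {A B} → ⟦ F ⟧ A → ⟦ F ⟧ B → ∣ A ∪ B ∣ ≤ s → Nonempty (A ∩ B)

-- π(A) = { π(a) : a ∈ A }: j lies in it exactly when π⁻¹(j) ∈ A.
image : ∀ {n} → Permutation′ n → Subset n → Subset n
image π A = tabulate (λ j → lookup A (π ⟨$⟩ˡ j))

-- P ≅ Q: some permutation of [n] carries P onto Q.  As image π is a bijection
-- of 2^[n], this says that P is the preimage of Q under it.
infix 4 _≅_
_≅_ : ∀ {n} → Pred (Subset n) 0ℓ → Pred (Subset n) 0ℓ → Set
_≅_ {n} P Q = ∃[ π ] P ≐ (λ A → Q (image {n} π A))

-- f a + f (a + 1) + ⋯ + f b, which is 0 when b < a.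
sumFromTo : ℕ → ℕ → (ℕ → ℕ) → ℕ
sumFromTo a b f = sum (applyUpTo (λ j → f (a + j)) (suc b ∸ a))

infix 6.2 sumFromTo
syntax sumFromTo a b (λ i → e) = ∑[ i ∈ a ⋯ b ] e

{-# OPTIONS --safe #-}

-- Choose an order of [n] uniformly at random.  A fixed set of positions then
-- carries a uniformly random set of its size.
--
-- Averaging over two disjoint sets of i and s − i positions, at most one of which
-- carries a member, shows for i < s − i that the levels i and s − i together have
-- at most C(n, s − i) members, with equality for s < n only if level i is empty.
-- Only the middle level of (i) and the levels of (iii) remain; these are
-- intersecting, and averaging over the n cyclic intervals of length k, at most k of
-- which carry members (Katona), gives the Erdős–Ko–Rado bound.
--
-- If that bound is attained and 2k < n, then in every order exactly k intervals
-- carry members, and these are consecutive.  Comparing suitable orders shows that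
-- the level is a star.  In (iii) it is enough that level 1 is attained: its only
-- member {x} meets every other member.
module Submission where

open import Defs
open import Data.Bool using (true; if_then_else_)
open import Data.Empty using (⊥)
open import Data.Fin using (Fin; zero; suc; toℕ; punchOut; fromℕ<)
open import Data.Fin.Permutation using (Permutation′; _⟨$⟩ˡ_; _⟨$⟩ʳ_; permutation; flip; inverseˡ; inverseʳ; _∘ₚ_; transpose)
import Data.Fin.Permutation.Components as PC
import Data.Fin.Properties as Fin
open import Data.Fin.Subset using (Subset; ∣_∣; _∈_; _∉_; _∪_; inside; outside; ⁅_⁆)
open import Data.Fin.Subset.Properties using (_∈?_; drop-there; ⊆-antisym; p⊂q⇒∣p∣<∣q∣; ∣⁅x⁆∣≡1; x∈⁅y⁆⇒x≡y; x∈p∩q⁻)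
open import Data.List using (List; []; _∷_; map; length; _++_; upTo; applyUpTo; allFin; cartesianProductWith; filter)
open import Data.List.Properties using (map-∘; map-++; map-applyUpTo; map-tabulate; length-tabulate; length-upTo)
import Data.List.Membership.DecPropositional as DecMembership
open import Data.List.Membership.Propositional using () renaming (_∈_ to _∈ˡ_)
open import Data.List.Membership.Propositional.Properties using (∈-upTo⁺; ∈-upTo⁻; ∈-allFin; ∈-cartesianProductWith⁺; ∈-map⁺; ∈-map⁻; ∈-filter⁺; ∈-filter⁻)
open import Data.List.Membership.Propositional.Properties.WithK using (unique∧set⇒bag)
open import Data.List.Relation.Binary.BagAndSetEquality using (∼bag⇒↭)
open import Data.List.Relation.Binary.Permutation.Propositional.Properties using () renaming (map⁺ to ↭-map⁺)
open import Data.List.Relation.Unary.All as All using ([]; _∷_)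
open import Data.List.Relation.Unary.AllPairs using ([]; _∷_)
open import Data.List.Relation.Unary.Any using (here; there)
open import Data.List.Relation.Unary.Unique.Propositional using (Unique)
import Data.List.Relation.Unary.Unique.Propositional.Properties as Unique
open import Data.Nat
open import Data.Nat.Combinatorics using (_C_; nCk+nC[k+1]≡[n+1]C[k+1]; nCk≡nC[n∸k]; nC1≡n)
open import Data.Nat.Combinatorics.Specification using (k>n⇒nCk≡0)
open import Data.Nat.DivMod using (_%_; _/_; [m+n]%n≡m%n; [m+kn]%n≡m%n; m%n<n; m%n≤n; m<n⇒m%n≡m; m%n%n≡m%n; m≡m%n+[m/n]*n; %-distribˡ-+)
open import Data.Nat.ListAction using (sum)
open import Data.Nat.ListAction.Properties using (sum-↭; sum-++)
open import Data.Nat.Properties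
open import Data.Nat.Tactic.RingSolver using (solve-∀)
open import Data.Product as Product using (_×_; _,_; proj₁; proj₂; ∃-syntax)
open import Data.Sum as Sum using (_⊎_; inj₁; inj₂)
open import Data.Vec using (Vec; []; _∷_; lookup; tabulate; here; there)
open import Data.Vec.Properties using (∷-injective; ≡-dec; lookup∘tabulate; tabulate∘lookup; tabulate-cong; lookup⇒[]=; []=⇒lookup)
open import Function using (_∘_; id; _⇔_; mk⇔; Equivalence)
open import Level using (0ℓ)
open import Relation.Binary.Definitions using (Tri; tri<; tri≈; tri>)
open import Relation.Binary.PropositionalEquality hiding (J)
open import Relation.Nullary using (Dec; yes; no; ¬_; ¬?; does; contradiction)
open import Relation.Nullary.Decidable using (_×-dec_; _⊎-dec_; _→-dec_; decidable-stable; True; toWitness)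
open import Relation.Unary using (Pred; _⊆_; _≐_)

-- All averages stay in ℕ, with denominators multiplied out. Write f i for the number of members of
-- size i. Disjoint position sets of sizes i and j give f i / C(n,i) + f j / C(n,j) ≤ 1. For i < j
-- and i + j ≤ n, C(n,i) ≤ C(n,j) with equality only at i + j = n, so it is best to fill level j,
-- and strictly best when s < n. The hypothesis u ≥ s - 1 keeps every partner s - i in range.
--
-- The star comes from the arcs at steps 1, ..., k, which are exactly the k-arcs through the last
-- position. A non-member A′ followed by a member A satisfies A = A′ - y + x, and an order that
-- shows A′ at step 0 and A at step 1 has x last, so all its k-arcs through x are members. It
-- remains to fit a given set B through x into such an order. This is direct if y is not in B;
-- otherwise the argument is repeated with another pair of arcs.
--
-- In (iii), s = n = 2u is allowed, and there maximum intersecting families of u-sets need not be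
-- stars; hence the centre is taken from level 1.

private variable
  α β P Q : Set
  n : ℕ

-- Indicators and finite sums

ind : {P : Set} → Dec P → ℕ
ind d = if does d then 1 else 0

ind-yes : (d : Dec P) → P → ind d ≡ 1
ind-yes (yes _) _ = refl
ind-yes (no ¬p) p = contradiction p ¬p

ind-no : (d : Dec P) → ¬ P → ind d ≡ 0
ind-no (yes p) ¬p = contradiction p ¬p
ind-no (no _)  _  = refl

ind⁻ : (d : Dec P) → ind d ≡ 1 → P
ind⁻ (yes p) _ = p

ind≤1 : (d : Dec P) → ind d ≤ 1
ind≤1 (yes _) = ≤-refl
ind≤1 (no _)  = z≤n

ind-⇔ : (d : Dec P) (e : Dec Q) → (P → Q) → (Q → P) → ind d ≡ ind e
ind-⇔ (yes p) e f g = sym (ind-yes e (f p))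
ind-⇔ (no ¬p) e f g = sym (ind-no e (¬p ∘ g))

ind-*-cong : (d : Dec P) {a b : ℕ} → (P → a ≡ b) → ind d * a ≡ ind d * b
ind-*-cong (yes p) h = cong (1 *_) (h p)
ind-*-cong (no _)  h = refl

ind-*-mono : (d : Dec P) {a b : ℕ} → (P → a ≤ b) → ind d * a ≤ ind d * b
ind-*-mono (yes p) h = *-monoʳ-≤ 1 (h p)
ind-*-mono (no _)  h = z≤n

total : List α → (α → ℕ) → ℕ
total xs f = sum (map f xs)

total-cong : ∀ (xs : List α) {f g} → (∀ {x} → x ∈ˡ xs → f x ≡ g x) → total xs f ≡ total xs g
total-cong []       h = refl
total-cong (x ∷ xs) h = cong₂ _+_ (h (here refl)) (total-cong xs (h ∘ there))

total-mono : ∀ (xs : List α) {f g} → (∀ {x} → x ∈ˡ xs → f x ≤ g x) → total xs f ≤ total xs g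
total-mono []       h = z≤n
total-mono (x ∷ xs) h = +-mono-≤ (h (here refl)) (total-mono xs (h ∘ there))

≤-sum-tight : ∀ {a b c d} → a ≤ b → c ≤ d → a + c ≡ b + d → a ≡ b × c ≡ d
≤-sum-tight {a} {b} {c} {d} a≤b c≤d eq with m≤n⇒m<n∨m≡n a≤b
... | inj₁ a<b  = contradiction eq (<⇒≢ (+-mono-<-≤ a<b c≤d))
... | inj₂ refl = refl , +-cancelˡ-≡ a c d eq

-- The equality cases rest on this: a bound proved term by term and attained in the sum is attained
-- in every term.
total-tight : ∀ (xs : List α) {f g} → (∀ {x} → x ∈ˡ xs → f x ≤ g x) →
              total xs f ≡ total xs g → ∀ {x} → x ∈ˡ xs → f x ≡ g x
total-tight (x ∷ xs) h eq p with ≤-sum-tight (h (here refl)) (total-mono xs (h ∘ there)) eq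
total-tight (x ∷ xs) h eq (here refl) | e , _ = e
total-tight (x ∷ xs) h eq (there p)   | _ , e = total-tight xs (h ∘ there) e p

total-+ : ∀ (xs : List α) f g → total xs (λ x → f x + g x) ≡ total xs f + total xs g
total-+ []       f g = refl
total-+ (x ∷ xs) f g rewrite total-+ xs f g = interchange (f x) (g x) (total xs f) (total xs g)
  where
  interchange : ∀ a b c d → a + b + (c + d) ≡ a + c + (b + d)
  interchange = solve-∀

total-*ˡ : ∀ (xs : List α) c f → total xs (λ x → c * f x) ≡ c * total xs f
total-*ˡ []       c f = sym (*-zeroʳ c)
total-*ˡ (x ∷ xs) c f rewrite total-*ˡ xs c f = sym (*-distribˡ-+ c (f x) (total xs f))

total-const : ∀ (xs : List α) c → total xs (λ _ → c) ≡ length xs * c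
total-const []       c = refl
total-const (x ∷ xs) c = cong (c +_) (total-const xs c)

total-0 : ∀ (xs : List α) {f} → (∀ {x} → x ∈ˡ xs → f x ≡ 0) → total xs f ≡ 0
total-0 xs h = trans (total-cong xs h) (trans (total-const xs 0) (*-zeroʳ (length xs)))

total-swap : ∀ (xs : List α) (ys : List β) (f : α → β → ℕ) →
             total xs (λ x → total ys (f x)) ≡ total ys (λ y → total xs (λ x → f x y))
total-swap []       ys f = sym (total-0 ys (λ _ → refl))
total-swap (x ∷ xs) ys f =
  trans (cong (total ys (f x) +_) (total-swap xs ys f)) (sym (total-+ ys (f x) _))

total-single : ∀ {xs : List α} {a} {f : α → ℕ} → Unique xs → a ∈ˡ xs →
               (∀ {x} → x ≢ a → f x ≡ 0) → total xs f ≡ f a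
total-single {xs = x ∷ xs} {f = f} (x∉ ∷ _) (here refl) h =
  trans (cong (f x +_) (total-0 xs (λ p → h λ { refl → All.lookup x∉ p refl }))) (+-identityʳ _)
total-single {xs = x ∷ xs} (x∉ ∷ u) (there p) h =
  cong₂ _+_ (h λ { refl → All.lookup x∉ p refl }) (total-single u p h)

term≤total : ∀ {xs : List α} {a} f → a ∈ˡ xs → f a ≤ total xs f
term≤total f (here refl) = m≤m+n _ _
term≤total f (there p)   = ≤-trans (term≤total f p) (m≤n+m _ _)

total-set : ∀ {xs ys : List α} f → Unique xs → Unique ys → (∀ {x} → x ∈ˡ xs ⇔ x ∈ˡ ys) →
            total xs f ≡ total ys f
total-set f u v s = sum-↭ (↭-map⁺ f (∼bag⇒↭ (unique∧set⇒bag u v s)))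

total-map : ∀ (g : α → β) (xs : List α) f → total (map g xs) f ≡ total xs (f ∘ g)
total-map g xs f = cong sum (sym (map-∘ xs))

total-reindex : ∀ {xs : List α} (f : α → ℕ) {g h : α → α} → Unique xs →
                (∀ {x} → x ∈ˡ xs → g x ∈ˡ xs) → (∀ {x} → x ∈ˡ xs → h x ∈ˡ xs) →
                (∀ x → g (h x) ≡ x) → (∀ x → h (g x) ≡ x) →
                total xs (f ∘ g) ≡ total xs f
total-reindex {xs = xs} f {g} {h} u g∈ h∈ gh hg = begin
  total xs (f ∘ g)   ≡⟨ total-map g xs f ⟨
  total (map g xs) f ≡⟨ total-set f (Unique.map⁺ (λ {x} {y} e → trans (sym (hg x)) (trans (cong h e) (hg y))) u) u (mk⇔ to from) ⟩
  total xs f         ∎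
  where
  open ≡-Reasoning
  to : ∀ {x} → x ∈ˡ map g xs → x ∈ˡ xs
  to p with y , q , refl ← ∈-map⁻ g p = g∈ q
  from : ∀ {x} → x ∈ˡ xs → x ∈ˡ map g xs
  from {x} p = subst (_∈ˡ map g xs) (gh x) (∈-map⁺ g (h∈ p))

total-++ : ∀ (xs ys : List α) f → total (xs ++ ys) f ≡ total xs f + total ys f
total-++ xs ys f = trans (cong sum (map-++ f xs ys)) (sum-++ (map f xs) (map f ys))

total-cartesian : ∀ {γ : Set} (g : α → β → γ) xs ys f →
                  total (cartesianProductWith g xs ys) f ≡ total xs (λ x → total ys (λ y → f (g x y)))
total-cartesian g []       ys f = refl
total-cartesian g (x ∷ xs) ys f = trans (total-++ (map (g x) ys) _ f)
  (cong₂ _+_ (total-map (g x) ys f) (total-cartesian g xs ys f))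

-- Sums over initial segments of ℕ

range : ℕ → (ℕ → ℕ) → ℕ
range m f = sum (applyUpTo f m)

range≡total : ∀ m f → range m f ≡ total (upTo m) f
range≡total m f = cong sum (sym (map-applyUpTo id f m))

range-cong : ∀ m {f g} → (∀ {i} → i < m → f i ≡ g i) → range m f ≡ range m g
range-cong m {f} {g} h =
  trans (range≡total m f) (trans (total-cong (upTo m) (h ∘ ∈-upTo⁻)) (sym (range≡total m g)))

range-mono : ∀ m {f g} → (∀ {i} → i < m → f i ≤ g i) → range m f ≤ range m g
range-mono m {f} {g} h rewrite range≡total m f | range≡total m g = total-mono (upTo m) (h ∘ ∈-upTo⁻)

range-tight : ∀ m {f g} → (∀ {i} → i < m → f i ≤ g i) → range m f ≡ range m g →
              ∀ {i} → i < m → f i ≡ g i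
range-tight m {f} {g} h e i<m rewrite range≡total m f | range≡total m g =
  total-tight (upTo m) (h ∘ ∈-upTo⁻) e (∈-upTo⁺ i<m)

range-+ : ∀ m f g → range m (λ i → f i + g i) ≡ range m f + range m g
range-+ m f g rewrite range≡total m f | range≡total m g =
  trans (range≡total m _) (total-+ (upTo m) f g)

range-split : ∀ a b f → range (a + b) f ≡ range a f + range b (λ i → f (a + i))
range-split zero    b f = refl
range-split (suc a) b f rewrite range-split a b (f ∘ suc) = sym (+-assoc (f 0) _ _)

range-last : ∀ m f → range (suc m) f ≡ range m f + f m
range-last m f = begin
  range (suc m) f             ≡⟨ cong (λ l → range l f) (+-comm 1 m) ⟩
  range (m + 1) f             ≡⟨ range-split m 1 f ⟩
  range m f + (f (m + 0) + 0) ≡⟨ cong (range m f +_) (trans (+-identityʳ _) (cong f (+-identityʳ m))) ⟩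
  range m f + f m             ∎
  where open ≡-Reasoning

range-reverse : ∀ m f → range m (λ i → f (m ∸ suc i)) ≡ range m f
range-reverse zero    f = refl
range-reverse (suc m) f = begin
  f m + range m (λ i → f (m ∸ suc i)) ≡⟨ cong (f m +_) (range-reverse m f) ⟩
  f m + range m f                     ≡⟨ +-comm (f m) _ ⟩
  range m f + f m                     ≡⟨ range-last m f ⟨
  range (suc m) f                     ∎
  where open ≡-Reasoning

range-shift : ∀ m f → f m ≡ f 0 → range m (f ∘ suc) ≡ range m f
range-shift m f e = +-cancelˡ-≡ (f 0) _ _ (begin
  range (suc m) f  ≡⟨ range-last m f ⟩
  range m f + f m  ≡⟨ cong (range m f +_) e ⟩
  range m f + f 0  ≡⟨ +-comm (range m f) (f 0) ⟩
  f 0 + range m f  ∎)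
  where open ≡-Reasoning

-- Moving the window by one trades the term at `j` for the one at `j + m`, and these agree by
-- periodicity.
range-rotate : ∀ m f → (∀ i → f (i + m) ≡ f i) → ∀ j → range m (λ i → f (j + i)) ≡ range m f
range-rotate m f per zero    = refl
range-rotate m f per (suc j) = trans
  (range-cong m (λ {i} _ → cong f (sym (+-suc j i))))
  (trans (range-shift m (λ i → f (j + i)) (trans (per j) (cong f (sym (+-identityʳ j)))))
         (range-rotate m f per j))

range-const : ∀ m c → range m (λ _ → c) ≡ m * c
range-const zero    c = refl
range-const (suc m) c = cong (c +_) (range-const m c)

-- Enumerating and counting subsets

-- The alphabet is a parameter because the same enumeration serves subsets (two letters) and orders
-- (letters in `Fin n`).
vectors : List α → ∀ n → List (Vec α n)
vectors xs zero    = [] ∷ []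
vectors xs (suc n) = cartesianProductWith _∷_ xs (vectors xs n)

vectors-unique : ∀ {xs : List α} → Unique xs → ∀ n → Unique (vectors xs n)
vectors-unique u zero    = [] ∷ []
vectors-unique u (suc n) = Unique.cartesianProductWith⁺ _∷_ ∷-injective u (vectors-unique u n)

∈-vectors : ∀ {xs : List α} → (∀ x → x ∈ˡ xs) → ∀ {n} (v : Vec α n) → v ∈ˡ vectors xs n
∈-vectors all []      = here refl
∈-vectors all (x ∷ v) = ∈-cartesianProductWith⁺ _∷_ (all x) (∈-vectors all v)

subsets : ∀ n → List (Subset n)
subsets = vectors (outside ∷ inside ∷ [])

subsets-unique : ∀ n → Unique (subsets n)
subsets-unique = vectors-unique (((λ ()) ∷ []) ∷ [] ∷ [])

∈-subsets : ∀ {n} (A : Subset n) → A ∈ˡ subsets n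
∈-subsets = ∈-vectors λ { outside → here refl ; inside → there (here refl) }

total-subsets : ∀ {n} f → total (subsets (suc n)) f ≡
                total (subsets n) (f ∘ (outside ∷_)) + total (subsets n) (f ∘ (inside ∷_))
total-subsets {n} f = trans (total-cartesian _∷_ (outside ∷ inside ∷ []) (subsets n) f)
  (cong (total (subsets n) (f ∘ (outside ∷_)) +_) (+-identityʳ _))

size? : ∀ {n} i (A : Subset n) → Dec (∣ A ∣ ≡ i)
size? i A = ∣ A ∣ ≟ i

count-level : ∀ n i → total (subsets n) (λ A → ind (size? i A)) ≡ n C i
count-level zero zero = refl
count-level zero (suc i) = sym (k>n⇒nCk≡0 (s≤s (z≤n {i})))
count-level (suc n) zero = begin
  total (subsets (suc n)) (λ A → ind (size? 0 A)) ≡⟨ total-subsets {n} _ ⟩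
  total (subsets n) (λ A → ind (size? 0 A)) + total (subsets n) (λ A → 0)
    ≡⟨ cong₂ _+_ (count-level n 0) (total-0 (subsets n) (λ _ → refl)) ⟩
  n C 0 + 0 ≡⟨⟩
  1 ∎
  where open ≡-Reasoning
count-level (suc n) (suc i) = begin
  total (subsets (suc n)) (λ A → ind (size? (suc i) A)) ≡⟨ total-subsets {n} _ ⟩
  total (subsets n) (λ A → ind (size? (suc i) A)) + total (subsets n) (λ A → ind (suc ∣ A ∣ ≟ suc i))
    ≡⟨ cong₂ _+_ (count-level n (suc i))
         (trans (total-cong (subsets n) (λ {A} _ → ind-⇔ (suc ∣ A ∣ ≟ suc i) (size? i A) suc-injective (cong suc)))
                (count-level n i)) ⟩
  n C suc i + n C i ≡⟨ +-comm (n C suc i) _ ⟩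
  n C i + n C suc i ≡⟨ nCk+nC[k+1]≡[n+1]C[k+1] n i ⟩
  suc n C suc i ∎
  where open ≡-Reasoning

size-0 : ∀ {n} {x : Fin n} (A : Subset n) → ∣ A ∣ ≡ 0 → x ∉ A
size-0 (outside ∷ A) e (there p) = size-0 A e p

count-star : ∀ m (x : Fin (suc m)) i →
             total (subsets (suc m)) (λ A → ind (size? (suc i) A) * ind (x ∈? A)) ≡ m C i
count-star m zero i = begin
  total (subsets (suc m)) (λ A → ind (size? (suc i) A) * ind (zero ∈? A)) ≡⟨ total-subsets {m} _ ⟩
  total (subsets m) (λ A → ind (size? (suc i) A) * 0) + total (subsets m) (λ A → ind (suc ∣ A ∣ ≟ suc i) * 1)
    ≡⟨ cong₂ _+_ (total-0 (subsets m) (λ {A} _ → *-zeroʳ (ind (size? (suc i) A))))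
                 (total-cong (subsets m) (λ {A} _ → trans (*-identityʳ _)
                    (ind-⇔ (suc ∣ A ∣ ≟ suc i) (size? i A) suc-injective (cong suc)))) ⟩
  total (subsets m) (λ A → ind (size? i A)) ≡⟨ count-level m i ⟩
  m C i ∎
  where open ≡-Reasoning
count-star (suc m) (suc x) i = begin
  total (subsets (2 + m)) (λ A → ind (size? (suc i) A) * ind (suc x ∈? A)) ≡⟨ total-subsets {suc m} _ ⟩
  total (subsets (suc m)) (λ A → ind (size? (suc i) A) * ind (suc x ∈? (outside ∷ A))) +
  total (subsets (suc m)) (λ A → ind (suc ∣ A ∣ ≟ suc i) * ind (suc x ∈? (inside ∷ A)))
    ≡⟨ cong₂ _+_
        (total-cong (subsets (suc m)) (λ {A} _ → cong (ind (size? (suc i) A) *_)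
           (ind-⇔ (suc x ∈? (outside ∷ A)) (x ∈? A) drop-there there)))
        (total-cong (subsets (suc m)) (λ {A} _ → cong₂ _*_
           (ind-⇔ (suc ∣ A ∣ ≟ suc i) (size? i A) suc-injective (cong suc))
           (ind-⇔ (suc x ∈? (inside ∷ A)) (x ∈? A) drop-there there))) ⟩
  total (subsets (suc m)) (λ A → ind (size? (suc i) A) * ind (x ∈? A)) +
  total (subsets (suc m)) (λ A → ind (size? i A) * ind (x ∈? A))
    ≡⟨ cong₂ _+_ (count-star m x i) refl ⟩
  m C i + total (subsets (suc m)) (λ A → ind (size? i A) * ind (x ∈? A)) ≡⟨ step i ⟩
  suc m C i ∎
  where
  open ≡-Reasoning
  -- Pascal's rule. The case `i = 0` stands apart because the second summand would be a binomial
  -- coefficient with lower index -1; there it vanishes since the empty set misses `x`.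
  step : ∀ i → m C i + total (subsets (suc m)) (λ A → ind (size? i A) * ind (x ∈? A)) ≡ suc m C i
  step zero = cong (1 +_) (total-0 (subsets (suc m)) λ {A} _ → trans
    (ind-*-cong (size? 0 A) (λ e → ind-no (x ∈? A) (size-0 A e))) (*-zeroʳ (ind (size? 0 A))))
  step (suc i) = begin
    m C suc i + total (subsets (suc m)) (λ A → ind (size? (suc i) A) * ind (x ∈? A))
      ≡⟨ cong (m C suc i +_) (count-star m x i) ⟩
    m C suc i + m C i ≡⟨ +-comm (m C suc i) _ ⟩
    m C i + m C suc i ≡⟨ nCk+nC[k+1]≡[n+1]C[k+1] m i ⟩
    suc m C suc i ∎

∣∣≡total : ∀ {n} (A : Subset n) → ∣ A ∣ ≡ total (allFin n) (λ e → ind (e ∈? A))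
∣∣≡total [] = refl
∣∣≡total {suc n} (b ∷ A) = trans (split b) (cong (ind (zero ∈? (b ∷ A)) +_) (begin
  ∣ A ∣ ≡⟨ ∣∣≡total A ⟩
  total (allFin n) (λ e → ind (e ∈? A))
    ≡⟨ total-cong (allFin n) (λ {e} _ → ind-⇔ (e ∈? A) (suc e ∈? (b ∷ A)) there drop-there) ⟩
  total (allFin n) (λ e → ind (suc e ∈? (b ∷ A))) ≡⟨ total-map suc (allFin n) _ ⟨
  total (map suc (allFin n)) (λ e → ind (e ∈? (b ∷ A)))
    ≡⟨ cong (λ l → total l (λ e → ind (e ∈? (b ∷ A)))) (map-tabulate id suc) ⟩
  total (Data.List.tabulate suc) (λ e → ind (e ∈? (b ∷ A))) ∎))
  where
  open ≡-Reasoning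
  split : ∀ b → ∣ b ∷ A ∣ ≡ ind (zero ∈? (b ∷ A)) + ∣ A ∣
  split outside = refl
  split inside  = refl

total-mono-< : ∀ {xs : List α} {a f g} → a ∈ˡ xs → (∀ {x} → x ∈ˡ xs → f x ≤ g x) →
               f a < g a → total xs f < total xs g
total-mono-< {xs = xs} a∈ h lt = ≤∧≢⇒< (total-mono xs h) λ e → <⇒≢ lt (total-tight xs h e a∈)

module _ {Q : Fin n → Set} (Q? : ∀ e → Dec (Q e)) where

  setOf : Subset n
  setOf = tabulate (does ∘ Q?)

  ∈-setOf⁺ : ∀ {e} → Q e → e ∈ setOf
  ∈-setOf⁺ {e} q = lookup⇒[]= e _ (trans (lookup∘tabulate _ e) (lemma (Q? e)))
    where
    lemma : (d : Dec (Q e)) → does d ≡ true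
    lemma (yes _) = refl
    lemma (no ¬q) = contradiction q ¬q

  ∈-setOf⁻ : ∀ {e} → e ∈ setOf → Q e
  ∈-setOf⁻ {e} p = lemma (Q? e) (trans (sym (lookup∘tabulate _ e)) ([]=⇒lookup p))
    where
    lemma : (d : Dec (Q e)) → does d ≡ true → Q e
    lemma (yes q) _ = q

  ∣setOf∣ : ∣ setOf ∣ ≡ total (allFin n) (ind ∘ Q?)
  ∣setOf∣ = trans (∣∣≡total setOf) (total-cong (allFin n) λ {e} _ → ind-⇔ (e ∈? setOf) (Q? e) ∈-setOf⁻ ∈-setOf⁺)

subset-ext : ∀ {A B : Subset n} → (∀ {e} → e ∈ A → e ∈ B) → (∀ {e} → e ∈ B → e ∈ A) → A ≡ B
subset-ext f g = ⊆-antisym f g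

-- Permutations of the ground set

module _ (π : Permutation′ n) where

  ∈-image⁺ : ∀ {A : Subset n} {j} → π ⟨$⟩ˡ j ∈ A → j ∈ image π A
  ∈-image⁺ {A} {j} p = lookup⇒[]= j _ (trans (lookup∘tabulate _ j) ([]=⇒lookup p))

  ∈-image⁻ : ∀ {A : Subset n} {j} → j ∈ image π A → π ⟨$⟩ˡ j ∈ A
  ∈-image⁻ {A} {j} p = lookup⇒[]= _ A (trans (sym (lookup∘tabulate _ j)) ([]=⇒lookup p))

  ∣image∣ : ∀ (A : Subset n) → ∣ image π A ∣ ≡ ∣ A ∣
  ∣image∣ A = begin
    ∣ image π A ∣ ≡⟨ ∣∣≡total (image π A) ⟩
    total (allFin n) (λ j → ind (j ∈? image π A))
      ≡⟨ total-cong (allFin n) (λ {j} _ → ind-⇔ (j ∈? image π A) (π ⟨$⟩ˡ j ∈? A) ∈-image⁻ ∈-image⁺) ⟩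
    total (allFin n) (λ j → ind (π ⟨$⟩ˡ j ∈? A))
      ≡⟨ total-reindex (λ j → ind (j ∈? A)) {π ⟨$⟩ˡ_} {π ⟨$⟩ʳ_} (Unique.allFin⁺ n) (λ _ → ∈-allFin _) (λ _ → ∈-allFin _) (λ _ → inverseˡ π) (λ _ → inverseʳ π) ⟩
    total (allFin n) (λ e → ind (e ∈? A)) ≡⟨ ∣∣≡total A ⟨
    ∣ A ∣ ∎
    where open ≡-Reasoning

image-injective : ∀ (π : Permutation′ n) {A B} → image π A ≡ image π B → A ≡ B
image-injective π {A} {B} eq = subset-ext (half eq) (half (sym eq))
  where
  half : ∀ {A B e} → image π A ≡ image π B → e ∈ A → e ∈ B
  half {A} {B} eq e∈A = subst (_∈ B) (inverseˡ π)
    (∈-image⁻ π (subst (_ ∈_) eq (∈-image⁺ π (subst (_∈ A) (sym (inverseˡ π)) e∈A))))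

Injective : (Fin n → Fin n) → Set
Injective f = ∀ i j → f i ≡ f j → i ≡ j

-- Pigeonhole: a missed value could be punched out, leaving an injection into a smaller `Fin`.
injective⇒surjective : (f : Fin n → Fin n) → Injective f → ∀ j → ∃[ i ] f i ≡ j
injective⇒surjective {suc n} f inj j with Fin.any? (λ i → f i Fin.≟ j)
... | yes p = p
... | no ¬p = contradiction
  (Fin.injective⇒≤ {f = λ i → punchOut {i = j} {j = f i} (λ e → ¬p (i , sym e))}
    (λ {a} {b} e → inj a b (Fin.punchOut-injective {i = j} (λ e → ¬p (a , sym e)) (λ e → ¬p (b , sym e)) e)))
  1+n≰n

injective⇒permutation : (f : Fin n → Fin n) → Injective f → Permutation′ n
injective⇒permutation f inj = permutation f (proj₁ ∘ sur)
  (λ j → proj₂ (sur j)) (λ i → inj _ _ (proj₂ (sur (f i))))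
  where sur = injective⇒surjective f inj

-- The ranking of the elements by colour, ties broken arbitrarily: every
-- sublevel set of the colouring becomes an initial segment.
module _ (col : Fin n → ℕ) where

  private
    infix 4 _≺_ _≺?_
    _≺_ : Fin n → Fin n → Set
    a ≺ b = col a < col b ⊎ (col a ≡ col b × toℕ a < toℕ b)

    _≺?_ : ∀ a b → Dec (a ≺ b)
    a ≺? b = col a <? col b ⊎-dec (col a ≟ col b ×-dec toℕ a <? toℕ b)

    ≺-trans : ∀ {a b c} → a ≺ b → b ≺ c → a ≺ c
    ≺-trans (inj₁ p) (inj₁ q) = inj₁ (<-trans p q)
    ≺-trans {a} (inj₁ p) (inj₂ (e , _)) = inj₁ (subst (col a <_) e p)
    ≺-trans {c = c} (inj₂ (e , _)) (inj₁ q) = inj₁ (subst (_< col c) (sym e) q)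
    ≺-trans (inj₂ (e , p)) (inj₂ (e′ , q)) = inj₂ (trans e e′ , <-trans p q)

    ≺-irrefl : ∀ {a} → ¬ a ≺ a
    ≺-irrefl (inj₁ p) = <-irrefl refl p
    ≺-irrefl (inj₂ (_ , p)) = <-irrefl refl p

    ≺-connex : ∀ a b → a ≢ b → a ≺ b ⊎ b ≺ a
    ≺-connex a b a≢b with <-cmp (col a) (col b) | <-cmp (toℕ a) (toℕ b)
    ... | tri< p _ _ | _          = inj₁ (inj₁ p)
    ... | tri> _ _ p | _          = inj₂ (inj₁ p)
    ... | tri≈ _ e _ | tri< p _ _ = inj₁ (inj₂ (e , p))
    ... | tri≈ _ e _ | tri> _ _ p = inj₂ (inj₂ (sym e , p))
    ... | tri≈ _ e _ | tri≈ _ f _ = contradiction (Fin.toℕ-injective f) a≢b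

    rankℕ : Fin n → ℕ
    rankℕ e = total (allFin n) (λ a → ind (a ≺? e))

    ind-mono : ∀ {P Q : Set} (d : Dec P) (d′ : Dec Q) → (P → Q) → ind d ≤ ind d′
    ind-mono (yes p) d′ f = ≤-reflexive (sym (ind-yes d′ (f p)))
    ind-mono (no _)  d′ f = z≤n

    rankℕ-mono : ∀ {a b} → a ≺ b → rankℕ a < rankℕ b
    rankℕ-mono {a} {b} a≺b = total-mono-< (∈-allFin a)
      (λ {x} _ → ind-mono (x ≺? a) (x ≺? b) (λ p → ≺-trans p a≺b))
      (subst₂ _<_ (sym (ind-no (a ≺? a) ≺-irrefl)) (sym (ind-yes (a ≺? b) a≺b)) z<s)

    rankℕ<n : ∀ e → rankℕ e < n
    rankℕ<n e = subst (rankℕ e <_) (trans (total-const (allFin n) 1) (trans (*-identityʳ _) (length-tabulate {n = n} id)))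
      (total-mono-< (∈-allFin e) (λ {x} _ → ind≤1 (x ≺? e)) (subst (_< 1) (sym (ind-no (e ≺? e) ≺-irrefl)) z<s))

    rank : Fin n → Fin n
    rank e = fromℕ< (rankℕ<n e)

    toℕ-rank : ∀ e → toℕ (rank e) ≡ rankℕ e
    toℕ-rank e = Fin.toℕ-fromℕ< (rankℕ<n e)

    rank-injective : Injective rank
    rank-injective a b e with a Fin.≟ b
    ... | yes p = p
    ... | no a≢b with eq ← trans (sym (toℕ-rank a)) (trans (cong toℕ e) (toℕ-rank b)) | ≺-connex a b a≢b
    ... | inj₁ p = contradiction eq (<⇒≢ (rankℕ-mono p))
    ... | inj₂ p = contradiction (sym eq) (<⇒≢ (rankℕ-mono p))

  sublevel : ℕ → ℕ
  sublevel t = total (allFin n) (λ e → ind (col e ≤? t))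

  ranking : Permutation′ n
  ranking = injective⇒permutation rank rank-injective

  ranking-≤ : ∀ {e t} → col e ≤ t → toℕ (ranking ⟨$⟩ʳ e) < sublevel t
  ranking-≤ {e} {t} le = subst (_< sublevel t) (sym (toℕ-rank e)) (total-mono-< (∈-allFin e)
    (λ {x} _ → ind-mono (x ≺? e) (col x ≤? t) (λ p → ≤-trans (≺⇒≤ p) le))
    (subst₂ _<_ (sym (ind-no (e ≺? e) ≺-irrefl)) (sym (ind-yes (col e ≤? t) le)) z<s))
    where
    ≺⇒≤ : ∀ {a b} → a ≺ b → col a ≤ col b
    ≺⇒≤ (inj₁ p) = <⇒≤ p
    ≺⇒≤ (inj₂ (e , _)) = ≤-reflexive e

  ranking-> : ∀ {e t} → t < col e → sublevel t ≤ toℕ (ranking ⟨$⟩ʳ e)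
  ranking-> {e} {t} lt = subst (sublevel t ≤_) (sym (toℕ-rank e)) (total-mono (allFin n)
    (λ {x} _ → ind-mono (col x ≤? t) (x ≺? e) (λ p → inj₁ (≤-<-trans p lt))))

-- Rank the elements once with `A` in front and once with `B` in front. Sending each element to the
-- one of equal rank matches the two initial segments, which have the same length.
same-size⇒image : ∀ (A B : Subset n) → ∣ A ∣ ≡ ∣ B ∣ → ∃[ σ ] image σ A ≡ B
same-size⇒image {n} A B eq = ρ A ∘ₚ flip (ρ B) , subset-ext fwd bwd
  where
  colour : Subset n → Fin n → ℕ
  colour A e = 1 ∸ ind (e ∈? A)

  ρ : Subset n → Permutation′ n
  ρ A = ranking (colour A)

  members : ∀ A → sublevel (colour A) 0 ≡ ∣ A ∣
  members A = trans (total-cong (allFin n) (λ {e} _ → lemma (e ∈? A))) (sym (∣∣≡total A))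
    where
    lemma : ∀ {P : Set} (d : Dec P) → ind (1 ∸ ind d ≤? 0) ≡ ind d
    lemma (yes _) = refl
    lemma (no _)  = refl

  ∈⇒< : ∀ {A e} → e ∈ A → toℕ (ρ A ⟨$⟩ʳ e) < ∣ A ∣
  ∈⇒< {A} {e} p = subst (toℕ (ρ A ⟨$⟩ʳ e) <_) (members A)
    (ranking-≤ (colour A) {e} (≤-reflexive (cong (1 ∸_) (ind-yes (e ∈? A) p))))

  <⇒∈ : ∀ {A e} → toℕ (ρ A ⟨$⟩ʳ e) < ∣ A ∣ → e ∈ A
  <⇒∈ {A} {e} lt = decidable-stable (e ∈? A) λ ¬p → ≤⇒≯ (subst (_≤ toℕ (ρ A ⟨$⟩ʳ e)) (members A)
    (ranking-> (colour A) {e} (subst (0 <_) (sym (cong (1 ∸_) (ind-no (e ∈? A) ¬p))) z<s))) lt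

  fwd : ∀ {e} → e ∈ image (ρ A ∘ₚ flip (ρ B)) A → e ∈ B
  fwd {e} p = <⇒∈ (subst₂ _<_ (cong toℕ (inverseʳ (ρ A))) eq (∈⇒< (∈-image⁻ (ρ A ∘ₚ flip (ρ B)) p)))

  bwd : ∀ {e} → e ∈ B → e ∈ image (ρ A ∘ₚ flip (ρ B)) A
  bwd {e} p = ∈-image⁺ (ρ A ∘ₚ flip (ρ B))
    (<⇒∈ (subst₂ _<_ (cong toℕ (sym (inverseʳ (ρ A)))) (sym eq) (∈⇒< p)))

-- Averaging over all orders

-- An order is stored as the vector of the positions of the elements.
injective? : (w : Vec (Fin n) n) → Dec (Injective (lookup w))
injective? w = Fin.all? λ i → Fin.all? λ j → (lookup w i Fin.≟ lookup w j) →-dec (i Fin.≟ j)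

orders : ∀ n → List (Vec (Fin n) n)
orders n = filter injective? (vectors (allFin n) n)

orders-unique : ∀ n → Unique (orders n)
orders-unique n = Unique.filter⁺ injective? (vectors-unique (Unique.allFin⁺ n) n)

∈-orders⁺ : ∀ {w : Vec (Fin n) n} → Injective (lookup w) → w ∈ˡ orders n
∈-orders⁺ = ∈-filter⁺ injective? (∈-vectors ∈-allFin _)

∈-orders⁻ : ∀ {w : Vec (Fin n) n} → w ∈ˡ orders n → Injective (lookup w)
∈-orders⁻ {n} p = proj₂ (∈-filter⁻ injective? {xs = vectors (allFin n) n} p)

order : Permutation′ n → Vec (Fin n) n
order π = tabulate (π ⟨$⟩ʳ_)

permutation-injective : ∀ (π : Permutation′ n) → Injective (π ⟨$⟩ʳ_)
permutation-injective π i j e = trans (sym (inverseˡ π)) (trans (cong (π ⟨$⟩ˡ_) e) (inverseˡ π))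

∈-order : ∀ (π : Permutation′ n) → order π ∈ˡ orders n
∈-order π = ∈-orders⁺ λ i j e → permutation-injective π i j
  (trans (sym (lookup∘tabulate (π ⟨$⟩ʳ_) i)) (trans e (lookup∘tabulate (π ⟨$⟩ʳ_) j)))

orders-nonempty : ∀ n → 1 ≤ length (orders n)
orders-nonempty n = lemma (∈-order {n} Data.Fin.Permutation.id)
  where
  lemma : ∀ {xs : List α} {x} → x ∈ˡ xs → 1 ≤ length xs
  lemma {xs = _ ∷ _} _ = s≤s z≤n

-- The set of elements that stand at the positions in `P`.
pull : Vec (Fin n) n → Subset n → Subset n
pull w P = tabulate (λ e → lookup P (lookup w e))

∈-pull⁺ : ∀ {w : Vec (Fin n) n} {P e} → lookup w e ∈ P → e ∈ pull w P
∈-pull⁺ {e = e} p = lookup⇒[]= e _ (trans (lookup∘tabulate _ e) ([]=⇒lookup p))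

∈-pull⁻ : ∀ {w : Vec (Fin n) n} {P e} → e ∈ pull w P → lookup w e ∈ P
∈-pull⁻ {P = P} {e} p = lookup⇒[]= _ P (trans (sym (lookup∘tabulate _ e)) ([]=⇒lookup p))

∣pull∣ : ∀ {w : Vec (Fin n) n} → w ∈ˡ orders n → ∀ P → ∣ pull w P ∣ ≡ ∣ P ∣
∣pull∣ {w = w} w∈ = ∣image∣ (flip (injective⇒permutation (lookup w) (∈-orders⁻ w∈)))

infix 4 _≟ˢ_
_≟ˢ_ : (A B : Subset n) → Dec (A ≡ B)
_≟ˢ_ = ≡-dec Data.Bool._≟_

-- For an indicator `φ` this is the number of members of size `i`. Arbitrary weights are allowed so
-- that stars and the constant weight 1 can be treated alike.
level : ∀ n → (Subset n → ℕ) → ℕ → ℕ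
level n φ i = total (subsets n) (λ A → ind (size? i A) * φ A)

relabel : Permutation′ n → Vec (Fin n) n → Vec (Fin n) n
relabel σ w = tabulate (λ e → lookup w (σ ⟨$⟩ˡ e))

total-relabel : ∀ (σ : Permutation′ n) f → total (orders n) (f ∘ relabel σ) ≡ total (orders n) f
total-relabel {n} σ f = total-reindex f (orders-unique n) (∈-relabel σ) (∈-relabel (flip σ))
  (cancel σ (flip σ) (inverseʳ σ)) (cancel (flip σ) σ (inverseˡ σ))
  where
  ∈-relabel : ∀ σ {w} → w ∈ˡ orders n → relabel σ w ∈ˡ orders n
  ∈-relabel σ {w} w∈ = ∈-orders⁺ λ i j e → permutation-injective (flip σ) i j
    (∈-orders⁻ w∈ _ _ (trans (sym (lookup∘tabulate _ i)) (trans e (lookup∘tabulate _ j))))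

  cancel : ∀ σ τ → (∀ {e} → τ ⟨$⟩ˡ (σ ⟨$⟩ˡ e) ≡ e) → ∀ w → relabel σ (relabel τ w) ≡ w
  cancel σ τ inv w = trans (tabulate-cong λ e → trans (lookup∘tabulate _ (σ ⟨$⟩ˡ e)) (cong (lookup w) inv)) (tabulate∘lookup w)

pull-relabel : ∀ (σ : Permutation′ n) w P → pull (relabel σ w) P ≡ image σ (pull w P)
pull-relabel σ w P = tabulate-cong λ e →
  trans (cong (lookup P) (lookup∘tabulate _ e)) (sym (lookup∘tabulate _ (σ ⟨$⟩ˡ e)))

-- The mean of `φ` over the sets carried by `P` in a random order equals its mean over the sets of
-- size `∣ P ∣`, with both denominators cleared. It holds because every set of that size is carried
-- by `P` in the same number `m` of orders.
average : ∀ (P : Subset n) (φ : Subset n → ℕ) →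
          (n C ∣ P ∣) * total (orders n) (λ w → φ (pull w P)) ≡ length (orders n) * level n φ ∣ P ∣
average {n} P φ = begin
  (n C p) * total (orders n) (λ w → φ (pull w P)) ≡⟨ cong ((n C p) *_) (spread φ) ⟩
  (n C p) * (m * level n φ p)                     ≡⟨ *-assoc (n C p) m _ ⟨
  (n C p) * m * level n φ p                       ≡⟨ cong (_* level n φ p) (*-comm (n C p) m) ⟩
  m * (n C p) * level n φ p                       ≡⟨ cong (_* level n φ p) mass ⟨
  length (orders n) * level n φ p                 ∎
  where
  open ≡-Reasoning
  p = ∣ P ∣

  hits : Subset n → ℕ
  hits A = total (orders n) (λ w → ind (pull w P ≟ˢ A))

  m = hits P

  -- Relabelling the elements by `σ` permutes the orders and turns those that put `A` at `P` into
  -- those that put `image σ A` there.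
  hits-image : ∀ σ A → hits (image σ A) ≡ hits A
  hits-image σ A = begin
    total (orders n) (λ w → ind (pull w P ≟ˢ image σ A))
      ≡⟨ total-relabel σ (λ w → ind (pull w P ≟ˢ image σ A)) ⟨
    total (orders n) (λ w → ind (pull (relabel σ w) P ≟ˢ image σ A))
      ≡⟨ total-cong (orders n) (λ {w} _ → ind-⇔ (pull (relabel σ w) P ≟ˢ image σ A) (pull w P ≟ˢ A)
           (λ e → image-injective σ (trans (sym (pull-relabel σ w P)) e))
           (λ e → trans (pull-relabel σ w P) (cong (image σ) e))) ⟩
    total (orders n) (λ w → ind (pull w P ≟ˢ A)) ∎

  hits-level : ∀ A → hits A ≡ m * ind (size? p A)
  hits-level A = helper (size? p A)
    where
    helper : (d : Dec (∣ A ∣ ≡ p)) → hits A ≡ m * ind d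
    helper (yes e) = let σ , eq = same-size⇒image P A (sym e) in
      trans (cong hits (sym eq)) (trans (hits-image σ P) (sym (*-identityʳ m)))
    helper (no ¬e) = trans (total-0 (orders n) λ {w} w∈ → ind-no (pull w P ≟ˢ A)
      λ eq → ¬e (trans (cong ∣_∣ (sym eq)) (∣pull∣ w∈ P))) (sym (*-zeroʳ m))

  spread : ∀ φ → total (orders n) (λ w → φ (pull w P)) ≡ m * level n φ p
  spread φ = begin
    total (orders n) (λ w → φ (pull w P))
      ≡⟨ total-cong (orders n) (λ {w} _ → sym (trans
           (total-single {f = λ A → ind (pull w P ≟ˢ A) * φ A} (subsets-unique n) (∈-subsets (pull w P))
             (λ {A} A≢ → cong (_* φ A) (ind-no (pull w P ≟ˢ A) (A≢ ∘ sym))))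
           (trans (cong (_* φ (pull w P)) (ind-yes (pull w P ≟ˢ pull w P) refl)) (*-identityˡ _)))) ⟩
    total (orders n) (λ w → total (subsets n) (λ A → ind (pull w P ≟ˢ A) * φ A))
      ≡⟨ total-swap (orders n) (subsets n) _ ⟩
    total (subsets n) (λ A → total (orders n) (λ w → ind (pull w P ≟ˢ A) * φ A))
      ≡⟨ total-cong (subsets n) (λ {A} _ → begin
           total (orders n) (λ w → ind (pull w P ≟ˢ A) * φ A)
             ≡⟨ total-cong (orders n) (λ {w} _ → *-comm (ind (pull w P ≟ˢ A)) (φ A)) ⟩
           total (orders n) (λ w → φ A * ind (pull w P ≟ˢ A)) ≡⟨ total-*ˡ (orders n) (φ A) _ ⟩
           φ A * hits A               ≡⟨ *-comm (φ A) _ ⟩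
           hits A * φ A               ≡⟨ cong (_* φ A) (hits-level A) ⟩
           m * ind (size? p A) * φ A  ≡⟨ *-assoc m _ _ ⟩
           m * (ind (size? p A) * φ A) ∎) ⟩
    total (subsets n) (λ A → m * (ind (size? p A) * φ A)) ≡⟨ total-*ˡ (subsets n) m _ ⟩
    m * level n φ p ∎

  -- The unknown multiplicity `m` is eliminated by taking the constant weight 1 in `spread`.
  mass : length (orders n) ≡ m * (n C p)
  mass = begin
    length (orders n)                 ≡⟨ *-identityʳ _ ⟨
    length (orders n) * 1             ≡⟨ total-const (orders n) 1 ⟨
    total (orders n) (λ _ → 1)        ≡⟨ spread (λ _ → 1) ⟩
    m * level n (λ _ → 1) p           ≡⟨ cong (m *_) (total-cong (subsets n) (λ {A} _ → *-identityʳ (ind (size? p A)))) ⟩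
    m * total (subsets n) (λ A → ind (size? p A)) ≡⟨ cong (m *_) (count-level n p) ⟩
    m * (n C p) ∎

-- Binomial coefficients

-- The ratio of neighbouring coefficients, (k + 1) C(n,k+1) = (n - k) C(n,k), written without
-- subtraction so that it holds for all `k`.
C-step : ∀ n k → suc k * (n C suc k) + k * (n C k) ≡ n * (n C k)
C-step zero zero = refl
C-step zero (suc k)
  rewrite k>n⇒nCk≡0 (s≤s (z≤n {suc k})) | k>n⇒nCk≡0 (s≤s (z≤n {k})) = cong₂ _+_ (*-zeroʳ k) (*-zeroʳ k)
C-step (suc n) zero = trans (+-identityʳ _) (trans (+-identityʳ _) (trans (nC1≡n (suc n)) (sym (*-identityʳ (suc n)))))
C-step (suc n) (suc k)
  rewrite sym (nCk+nC[k+1]≡[n+1]C[k+1] n (suc k)) | sym (nCk+nC[k+1]≡[n+1]C[k+1] n k) = begin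
  suc (suc k) * (b + c) + suc k * (a + b)                 ≡⟨ regroup k a b c ⟩
  (suc (suc k) * c + suc k * b) + (suc k * b + k * a) + (a + b)
    ≡⟨ cong (_+ (a + b)) (cong₂ _+_ (C-step n (suc k)) (C-step n k)) ⟩
  n * b + n * a + (a + b)                                 ≡⟨ collect n a b ⟩
  suc n * (a + b) ∎
  where
  open ≡-Reasoning
  a = n C k
  b = n C suc k
  c = n C suc (suc k)
  regroup : ∀ k a b c → suc (suc k) * (b + c) + suc k * (a + b) ≡
            (suc (suc k) * c + suc k * b) + (suc k * b + k * a) + (a + b)
  regroup = solve-∀
  collect : ∀ n a b → n * b + n * a + (a + b) ≡ suc n * (a + b)
  collect = solve-∀

C-absorb : ∀ m i → suc i * (suc m C suc i) ≡ suc m * (m C i)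
C-absorb m i rewrite sym (nCk+nC[k+1]≡[n+1]C[k+1] m i) = begin
  suc i * (a + b)         ≡⟨ regroup i a b ⟩
  suc i * b + i * a + a   ≡⟨ cong (_+ a) (C-step m i) ⟩
  m * a + a               ≡⟨ +-comm (m * a) a ⟩
  suc m * a               ∎
  where
  open ≡-Reasoning
  a = m C i
  b = m C suc i
  regroup : ∀ i a b → suc i * (a + b) ≡ suc i * b + i * a + a
  regroup = solve-∀

C-pos : ∀ {n k} → k ≤ n → 1 ≤ n C k
C-pos {n}     {zero}  _ = ≤-refl
C-pos {suc n} {suc k} (s≤s le) rewrite sym (nCk+nC[k+1]≡[n+1]C[k+1] n k) =
  ≤-trans (C-pos le) (m≤m+n (n C k) (n C suc k))

-- Otherwise the left side of `C-step` would be at most (2a + 1) x with x = C(n,a), which is less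
-- than (2a + 2) x ≤ n x because x is positive.
C-suc< : ∀ {n a} → 2 * suc a ≤ n → n C a < n C suc a
C-suc< {n} {a} le = ≰⇒> λ y≤x → <⇒≱ (too-small y≤x) (≤-trans (*-monoˡ-≤ x le) (≤-reflexive (sym (C-step n a))))
  where
  x = n C a
  y = n C suc a
  open ≤-Reasoning
  a≤n : a ≤ n
  a≤n = ≤-trans (n≤1+n a) (≤-trans (m≤m+n (suc a) _) le)
  collect : ∀ a x → suc (suc a * x + a * x) + x ≡ suc (2 * suc a * x)
  collect = solve-∀
  too-small : y ≤ x → suc a * y + a * x < 2 * suc a * x
  too-small y≤x = +-cancelʳ-< x _ _ (begin-strict
    suc a * y + a * x + x ≤⟨ +-monoˡ-≤ x (+-monoˡ-≤ (a * x) (*-monoʳ-≤ (suc a) y≤x)) ⟩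
    suc a * x + a * x + x <⟨ n<1+n _ ⟩
    suc (suc a * x + a * x + x) ≡⟨ collect a x ⟩
    suc (2 * suc a * x)   ≤⟨ +-monoˡ-≤ (2 * suc a * x) (C-pos a≤n) ⟩
    x + 2 * suc a * x     ≡⟨ +-comm x _ ⟩
    2 * suc a * x + x     ∎)

C-mono-< : ∀ {n a b} → a < b → 2 * b ≤ n → n C a < n C b
C-mono-< {n} {a} {suc b} (s≤s a≤b) le with m≤n⇒m<n∨m≡n a≤b
... | inj₂ refl = C-suc< le
... | inj₁ a<b  = <-trans (C-mono-< a<b (≤-trans (*-monoʳ-≤ 2 (n≤1+n b)) le)) (C-suc< le)

-- If `j` lies beyond the middle, replace it by `n ∸ j`, which lies in the lower half and is still
-- at least `i`. Strictness is lost only if the reflection lands on `i` itself.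
C-reflect : ∀ {n i j} → i < j → i + j ≤ n → (n C i < n C j) ⊎ (n C i ≡ n C j × i + j ≡ n)
C-reflect {n} {i} {j} i<j le with 2 * j ≤? n
... | yes 2j≤n = inj₁ (C-mono-< i<j 2j≤n)
... | no  2j≰n with m≤n⇒m<n∨m≡n (m+n≤o⇒m≤o∸n i le)
...   | inj₁ i<n∸j = inj₁ (subst (n C i <_) (sym (nCk≡nC[n∸k] j≤n)) (C-mono-< i<n∸j half))
  where
  j≤n : j ≤ n
  j≤n = m+n≤o⇒n≤o i le
  half : 2 * (n ∸ j) ≤ n
  half = begin
    (n ∸ j) + ((n ∸ j) + 0) ≡⟨ cong ((n ∸ j) +_) (+-identityʳ (n ∸ j)) ⟩
    (n ∸ j) + (n ∸ j)       ≤⟨ +-monoʳ-≤ (n ∸ j) (m≤n+o⇒m∸n≤o n j (≤-trans (<⇒≤ (≰⇒> 2j≰n)) (≤-reflexive (cong (j +_) (+-identityʳ j))))) ⟩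
    (n ∸ j) + j             ≡⟨ m∸n+n≡m j≤n ⟩
    n                       ∎
    where open ≤-Reasoning
...   | inj₂ i≡n∸j = inj₂ (trans (cong (n C_) i≡n∸j) (sym (nCk≡nC[n∸k] j≤n)) ,
                           trans (cong (_+ j) i≡n∸j) (m∸n+n≡m j≤n))
  where
  j≤n : j ≤ n
  j≤n = m+n≤o⇒n≤o i le

-- Katona's argument on a cycle of length k + r + k: X j says whether the arc of
-- length k starting at j belongs to the family.
module Cycle (k r : ℕ) (X : ℕ → ℕ) (X≤1 : ∀ j → X j ≤ 1)
             (periodic : ∀ j → X (j + (k + (r + k))) ≡ X j)
             (disjoint : ∀ j {d} → k ≤ d → d ≤ k + r → X j + X (j + d) ≤ 1) where

  private
    len = k + (r + k)

    shunted : ∀ {j d} → X j ≡ 1 → k ≤ d → d ≤ k + r → X (j + d) ≡ 0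
    shunted {j} {d} e k≤d d≤ = n≤0⇒n≡0 (s≤s⁻¹ (subst (λ x → x + X (j + d) ≤ 1) e (disjoint j k≤d d≤)))

    pair : ℕ → ℕ → ℕ
    pair j i = X (j + i) + X (j + i + (k + r))

    pair≤1 : ∀ j i → pair j i ≤ 1
    pair≤1 j i = disjoint (j + i) (m≤m+n k r) ≤-refl

    -- Seen from a member arc at `j`, the arcs at offsets k, ..., k + r - 1 are disjoint from it and
    -- drop out. The other 2k arcs are paired as i with i + k + r; around the cycle the latter is i
    -- - k, so the two arcs of a pair are disjoint.
    fold-pairs : ∀ {j} → X j ≡ 1 → range len X ≡ range k (pair j)
    fold-pairs {j} e = begin
      range len X ≡⟨ range-rotate len X periodic j ⟨
      range len Y ≡⟨ range-split k (r + k) Y ⟩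
      range k Y + range (r + k) (λ i → Y (k + i)) ≡⟨ cong (range k Y +_) (range-split r k _) ⟩
      range k Y + (range r (λ i → Y (k + i)) + range k (λ i → Y (k + (r + i))))
        ≡⟨ cong (range k Y +_) (cong (_+ range k (λ i → Y (k + (r + i))))
             (trans (range-cong r (λ {i} i<r → shunted {j} e (m≤m+n k i) (+-monoʳ-≤ k (<⇒≤ i<r))))
                    (trans (range-const r 0) (*-zeroʳ r)))) ⟩
      range k Y + range k (λ i → Y (k + (r + i))) ≡⟨ range-+ k Y _ ⟨
      range k (λ i → Y i + Y (k + (r + i)))
        ≡⟨ range-cong k (λ {i} _ → cong (λ z → Y i + X z) (rearrange j k r i)) ⟩
      range k (pair j) ∎
      where
      open ≡-Reasoning
      Y : ℕ → ℕ
      Y i = X (j + i)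
      rearrange : ∀ j k r i → j + (k + (r + i)) ≡ j + i + (k + r)
      rearrange = solve-∀

    X-dec : ∀ j → X j ≡ 0 ⊎ X j ≡ 1
    X-dec j with X j | X≤1 j
    ... | 0 | _ = inj₁ refl
    ... | 1 | _ = inj₂ refl
    ... | suc (suc _) | s≤s ()

    hit-or-empty : ∀ m → (∃[ j ] X j ≡ 1) ⊎ range m X ≡ 0
    hit-or-empty m with anyUpTo? (λ j → X j ≟ 1) m
    ... | yes (j , _ , e) = inj₁ (j , e)
    ... | no none = inj₂ (trans (range-cong m λ {i} i<m → zero-at i<m (X-dec i))
                                (trans (range-const m 0) (*-zeroʳ m)))
      where
      zero-at : ∀ {i} → i < m → X i ≡ 0 ⊎ X i ≡ 1 → X i ≡ 0
      zero-at i<m (inj₁ e) = e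
      zero-at i<m (inj₂ e) = contradiction (_ , i<m , e) none

    range-ones : ∀ m → range m (λ _ → 1) ≡ m
    range-ones m = trans (range-const m 1) (*-identityʳ m)

  katona : range len X ≤ k
  katona with hit-or-empty len
  ... | inj₁ (j , e) = subst₂ _≤_ (sym (fold-pairs e)) (range-ones k) (range-mono k (λ {i} _ → pair≤1 j i))
  ... | inj₂ e = subst (_≤ k) (sym e) z≤n

  module Tight (0<r : 0 < r) (0<k : 0 < k) (tight : range len X ≡ k) where

    private
      pair≡1 : ∀ {j} → X j ≡ 1 → ∀ {i} → i < k → pair j i ≡ 1
      pair≡1 {j} e = range-tight k (λ {i} _ → pair≤1 j i)
        (trans (sym (fold-pairs e)) (trans tight (sym (range-ones k))))

    -- When the bound is attained, each pair seen from a member contains exactly one member. Seen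
    -- from 1, the arc at k is paired with the one at 0, so it is a member. Seen from k, exactly one
    -- of i and k + i is a member. If j + 1 is a member, then j + k + 2 is not, since the distance k
    -- + 1 is at most k + r; hence j + 2 is.
    run : X 0 ≡ 0 → X 1 ≡ 1 → ∀ j → j < k → X (suc j) ≡ 1
    run X0 X1 = climb
      where
      last : ∀ l → suc l ≡ k → X k ≡ 1
      last l refl = begin
        X (suc l)                     ≡⟨ +-identityʳ _ ⟨
        X (suc l) + 0                 ≡⟨ cong (X (suc l) +_) (trans (periodic 0) X0) ⟨
        X (suc l) + X len               ≡⟨ cong (λ z → X (suc l) + X (suc l + z)) (+-comm r (suc l)) ⟩
        pair 1 l                      ≡⟨ pair≡1 X1 (n<1+n l) ⟩
        1                             ∎
        where open ≡-Reasoning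
      Xk : X k ≡ 1
      Xk = last (pred k) (suc-pred k {{>-nonZero 0<k}})
      opposite : ∀ {i} → i < k → X (k + i) + X i ≡ 1
      opposite {i} i<k = trans (cong (X (k + i) +_) (trans (sym (periodic i)) (cong X (shuffle i k r)))) (pair≡1 Xk i<k)
        where
        shuffle : ∀ i k r → i + (k + (r + k)) ≡ k + i + (k + r)
        shuffle = solve-∀
      climb : ∀ j → j < k → X (suc j) ≡ 1
      climb zero    _ = X1
      climb (suc j) le with m≤n⇒m<n∨m≡n le
      ... | inj₂ refl = Xk
      ... | inj₁ lt   = subst (λ z → z + X (2 + j) ≡ 1) gap (opposite lt)
        where
        shuffle : ∀ k j → suc j + suc k ≡ k + (2 + j)
        shuffle = solve-∀
        gap : X (k + (2 + j)) ≡ 0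
        gap = trans (cong X (sym (shuffle k j)))
          (shunted {suc j} (climb j (≤-trans (n≤1+n _) le)) (n≤1+n k)
            (subst (_≤ k + r) (+-comm k 1) (+-monoʳ-≤ k 0<r)))

    -- With exactly k members among k + r + k arcs there are both members and non-members, and a
    -- walk from a non-member to a member must cross over.
    entry : ∃[ j ] (X j ≡ 0 × X (suc j) ≡ 1)
    entry with hit-or-empty len | allUpTo? (λ j → X j ≟ 1) len
    ... | inj₂ e | _ = contradiction (subst (0 <_) (trans (sym tight) e) 0<k) λ ()
    ... | inj₁ _ | yes full = contradiction (trans (sym (trans (range-cong len (λ {i} i<n → full i<n)) (range-ones len))) tight)
          (λ e → <⇒≢ (m<m+n k (≤-trans 0<k (m≤n+m k r))) (sym e))
    ... | inj₁ (j₁ , e₁) | no ¬full with ¬∀⇒∃ ¬full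
      where
      ¬∀⇒∃ : ¬ (∀ {i} → i < len → X i ≡ 1) → ∃[ i ] (i < len × X i ≡ 0)
      ¬∀⇒∃ ¬all with anyUpTo? (λ j → X j ≟ 0) len
      ... | yes (i , lt , e) = i , lt , e
      ... | no none = contradiction (λ {i} lt → one lt (X-dec i)) ¬all
        where
        one : ∀ {i} → i < len → X i ≡ 0 ⊎ X i ≡ 1 → X i ≡ 1
        one lt (inj₁ e) = contradiction (_ , lt , e) none
        one lt (inj₂ e) = e
    -- A full turn is added to `j₁` so that the member lies ahead of `j₀`.
    ... | j₀ , j₀<n , e₀ = search (j₁ + len ∸ j₀) e₀
            (trans (cong X (m+[n∸m]≡n (≤-trans (<⇒≤ j₀<n) (m≤n+m len j₁)))) (trans (periodic j₁) e₁))
      where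
      search : ∀ d {j} → X j ≡ 0 → X (j + d) ≡ 1 → ∃[ j ] (X j ≡ 0 × X (suc j) ≡ 1)
      search zero {j} e f = contradiction (trans (sym e) (trans (cong X (sym (+-identityʳ j))) f)) λ ()
      search (suc d) {j} e f with X-dec (suc j)
      ... | inj₁ e′ = search d e′ (trans (cong X (sym (+-suc j d))) f)
      ... | inj₂ f′ = j , e , f′

-- Sets of positions

total-allFin : ∀ n (f : ℕ → ℕ) → total (allFin n) (f ∘ toℕ) ≡ range n f
total-allFin n f = trans (cong sum (map-tabulate {n = n} id (f ∘ toℕ))) (lemma n f)
  where
  lemma : ∀ n (f : ℕ → ℕ) → sum (Data.List.tabulate {n = n} (f ∘ toℕ)) ≡ range n f
  lemma zero    f = refl
  lemma (suc n) f = cong (f 0 +_) (lemma n (f ∘ suc))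

range-window : ∀ a b c (f : ℕ → ℕ) → (∀ i → i < a → f i ≡ 0) → (∀ i → i < b → f (a + i) ≡ 1) →
               (∀ i → f (a + b + i) ≡ 0) → range (a + b + c) f ≡ b
range-window a b c f before within after = begin
  range (a + b + c) f                        ≡⟨ range-split (a + b) c f ⟩
  range (a + b) f + range c (λ i → f (a + b + i)) ≡⟨ cong₂ _+_ (range-split a b f) (zeros c λ {i} _ → after i) ⟩
  range a f + range b (λ i → f (a + i)) + 0  ≡⟨ +-identityʳ _ ⟩
  range a f + range b (λ i → f (a + i))      ≡⟨ cong₂ _+_ (zeros a (before _)) (trans (range-cong b (within _)) (range-const b 1)) ⟩
  b * 1                                      ≡⟨ *-identityʳ b ⟩
  b ∎
  where
  open ≡-Reasoning
  zeros : ∀ m {g} → (∀ {i} → i < m → g i ≡ 0) → range m g ≡ 0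
  zeros m h = trans (range-cong m h) (trans (range-const m 0) (*-zeroʳ m))

module _ (n a b : ℕ) where

  interval? : (p : ℕ) → Dec (a ≤ p × p < a + b)
  interval? p = a ≤? p ×-dec p <? a + b

  interval : Subset n
  interval = setOf (interval? ∘ toℕ)

  ∣interval∣ : a + b ≤ n → ∣ interval ∣ ≡ b
  ∣interval∣ le = begin
    ∣ interval ∣                                    ≡⟨ ∣setOf∣ {n} (interval? ∘ toℕ) ⟩
    total (allFin n) (ind ∘ interval? ∘ toℕ)        ≡⟨ total-allFin n (ind ∘ interval?) ⟩
    range n (ind ∘ interval?)                       ≡⟨ cong (λ m → range m (ind ∘ interval?)) (m+[n∸m]≡n le) ⟨
    range (a + b + (n ∸ (a + b))) (ind ∘ interval?)
      ≡⟨ range-window a b _ _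
           (λ i i<a → ind-no (interval? i) λ (a≤i , _) → <⇒≱ i<a a≤i)
           (λ i i<b → ind-yes (interval? (a + i)) (m≤m+n a i , +-monoʳ-< a i<b))
           (λ i → ind-no (interval? (a + b + i)) λ (_ , lt) → <⇒≱ lt (m≤m+n (a + b) i)) ⟩
    b ∎
    where open ≡-Reasoning

module _ (n k : ℕ) .{{_ : NonZero n}} where

  arc? : ∀ j p → Dec ((p + j) % n < k)
  arc? j p = (p + j) % n <? k

  -- Adding `j` to the position moves the arc backwards: it begins at -j modulo `n`. So the arc at
  -- step 0 is the initial segment, and those at steps 1, ..., k contain the last position.
  arc : ℕ → Subset n
  arc j = setOf (arc? j ∘ toℕ)

  ∣arc∣ : k ≤ n → ∀ j → ∣ arc j ∣ ≡ k
  ∣arc∣ k≤n j = begin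
    ∣ arc j ∣                             ≡⟨ ∣setOf∣ {n} (arc? j ∘ toℕ) ⟩
    total (allFin n) (ind ∘ arc? j ∘ toℕ) ≡⟨ total-allFin n (ind ∘ arc? j) ⟩
    range n (λ p → ind (arc? j p))        ≡⟨ range-cong n (λ {p} _ → cong h (+-comm p j)) ⟩
    range n (λ p → h (j + p))             ≡⟨ range-rotate n h (λ i → cong (λ z → ind (z <? k)) ([m+n]%n≡m%n i n)) j ⟩
    range n h                             ≡⟨ range-cong n (λ i<n → cong (λ z → ind (z <? k)) (m<n⇒m%n≡m i<n)) ⟩
    range n (λ i → ind (i <? k))          ≡⟨ cong (λ m → range m (λ i → ind (i <? k))) (m+[n∸m]≡n k≤n) ⟨
    range (k + (n ∸ k)) (λ i → ind (i <? k))
      ≡⟨ range-window 0 k _ _ (λ _ ()) (λ i i<k → ind-yes (i <? k) i<k)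
           (λ i → ind-no (k + i <? k) (≤⇒≯ (m≤m+n k i))) ⟩
    k ∎
    where
    open ≡-Reasoning
    h : ℕ → ℕ
    h i = ind (i % n <? k)

  arc-periodic : ∀ j → arc (j + n) ≡ arc j
  arc-periodic j = subset-ext
    (λ {p} q → ∈-setOf⁺ (arc? j ∘ toℕ) (subst (_< k) (same p) (∈-setOf⁻ (arc? (j + n) ∘ toℕ) q)))
    (λ {p} q → ∈-setOf⁺ (arc? (j + n) ∘ toℕ) (subst (_< k) (sym (same p)) (∈-setOf⁻ (arc? j ∘ toℕ) q)))
    where
    same : ∀ (p : Fin n) → (toℕ p + (j + n)) % n ≡ (toℕ p + j) % n
    same p = trans (cong (_% n) (sym (+-assoc (toℕ p) j n))) ([m+n]%n≡m%n (toℕ p + j) n)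

  -- A residue a < k moves to a + d, which stays below `n`, so does not wrap around, and is at least
  -- `k`.
  arc-disjoint : ∀ j {d} → k ≤ d → d + k ≤ n → ∀ {p} → p ∈ arc j → p ∉ arc (j + d)
  arc-disjoint j {d} k≤d d+k≤n {p} q q′ = <⇒≱ a+d<k (≤-trans k≤d (m≤n+m d a))
    where
    a = (toℕ p + j) % n
    a<k : a < k
    a<k = ∈-setOf⁻ (arc? j ∘ toℕ) q
    a+d<n : a + d < n
    a+d<n = <-≤-trans (+-monoˡ-< d a<k) (subst (_≤ n) (+-comm d k) d+k≤n)
    d<n : d < n
    d<n = ≤-<-trans (m≤n+m d a) a+d<n
    a+d<k : a + d < k
    a+d<k = subst (_< k) (begin
      (toℕ p + (j + d)) % n     ≡⟨ cong (_% n) (+-assoc (toℕ p) j d) ⟨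
      (toℕ p + j + d) % n       ≡⟨ %-distribˡ-+ (toℕ p + j) d n ⟩
      (a + d % n) % n           ≡⟨ cong (λ z → (a + z) % n) (m<n⇒m%n≡m d<n) ⟩
      (a + d) % n               ≡⟨ m<n⇒m%n≡m a+d<n ⟩
      a + d ∎) (∈-setOf⁻ (arc? (j + d) ∘ toℕ) q′)
      where open ≡-Reasoning

-- Averaged inequalities for the levels

pull-disjoint : ∀ {n} {w : Vec (Fin n) n} {P Q} → (∀ {p} → p ∈ P → p ∉ Q) → ∀ {e} → e ∈ pull w P → e ∉ pull w Q
pull-disjoint {w = w} {P} {Q} h p q = h (∈-pull⁻ {w = w} {P} p) (∈-pull⁻ {w = w} {Q} q)

level≤C : ∀ {n} {φ : Subset n → ℕ} → (∀ A → φ A ≤ 1) → ∀ i → level n φ i ≤ n C i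
level≤C {n} {φ} φ≤1 i = subst (level n φ i ≤_) (count-level n i) (total-mono (subsets n) λ {A} _ →
  ≤-trans (*-monoʳ-≤ (ind (size? i A)) (φ≤1 A)) (≤-reflexive (*-identityʳ _)))

-- The indicator of a (2,s)-conditionally intersecting family, after weakening
-- ∣ A ∪ B ∣ ≤ s to ∣ A ∣ + ∣ B ∣ ≤ s.
module Spread {n s : ℕ} .{{_ : NonZero n}} (s≤n : s ≤ n) (φ : Subset n → ℕ) (φ≤1 : ∀ A → φ A ≤ 1)
              (spread : ∀ {A B} → ∣ A ∣ + ∣ B ∣ ≤ s → (∀ {e} → e ∈ A → e ∉ B) → φ A + φ B ≤ 1) where

  private
    N = length (orders n)
    instance
      N≢0 : NonZero N
      N≢0 = >-nonZero (orders-nonempty n)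

    f : ℕ → ℕ
    f = level n φ

    S : Subset n → ℕ
    S P = total (orders n) (λ w → φ (pull w P))

    average-at : ∀ P {i} → ∣ P ∣ ≡ i → (n C i) * S P ≡ N * f i
    average-at P refl = average P φ

    pull-spread : ∀ {w P Q} → w ∈ˡ orders n → ∣ P ∣ + ∣ Q ∣ ≤ s → (∀ {p} → p ∈ P → p ∉ Q) →
                  φ (pull w P) + φ (pull w Q) ≤ 1
    pull-spread {w} {P} {Q} w∈ le h = spread (subst (_≤ s) (sym (cong₂ _+_ (∣pull∣ w∈ P) (∣pull∣ w∈ Q))) le)
      (pull-disjoint {w = w} {P} {Q} h)

  -- The inequality f i / C(n,i) + f j / C(n,j) ≤ 1 without denominators, from adjacent intervals of
  -- `i` and `j` positions.
  cross : ∀ {i j} → i + j ≤ s → f i * (n C j) + f j * (n C i) ≤ (n C i) * (n C j)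
  cross {i} {j} le = *-cancelˡ-≤ N (begin
    N * (f i * (n C j) + f j * (n C i))       ≡⟨ expand N (f i) (f j) (n C i) (n C j) ⟩
    N * f i * (n C j) + N * f j * (n C i)     ≡⟨ cong₂ (λ x y → x * (n C j) + y * (n C i)) (average-at I ∣I∣) (average-at J ∣J∣) ⟨
    (n C i) * S I * (n C j) + (n C j) * S J * (n C i) ≡⟨ collect (n C i) (n C j) (S I) (S J) ⟩
    (n C i) * (n C j) * (S I + S J)           ≤⟨ *-monoʳ-≤ ((n C i) * (n C j)) few ⟩
    (n C i) * (n C j) * N                     ≡⟨ *-comm _ N ⟩
    N * ((n C i) * (n C j)) ∎)
    where
    open ≤-Reasoning
    I = interval n 0 i
    J = interval n i j
    ∣I∣ : ∣ I ∣ ≡ i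
    ∣I∣ = ∣interval∣ n 0 i (m+n≤o⇒m≤o i (≤-trans le s≤n))
    ∣J∣ : ∣ J ∣ ≡ j
    ∣J∣ = ∣interval∣ n i j (≤-trans le s≤n)
    disjoint : ∀ {p} → p ∈ I → p ∉ J
    disjoint p q = <⇒≱ (proj₂ (∈-setOf⁻ (interval? n 0 i ∘ toℕ) p)) (proj₁ (∈-setOf⁻ (interval? n i j ∘ toℕ) q))
    few : S I + S J ≤ N
    few = begin
      S I + S J                                            ≡⟨ total-+ (orders n) _ _ ⟨
      total (orders n) (λ w → φ (pull w I) + φ (pull w J)) ≤⟨ total-mono (orders n) (λ {w} w∈ → pull-spread {w} {I} {J} w∈ (subst (_≤ s) (sym (cong₂ _+_ ∣I∣ ∣J∣)) le) disjoint) ⟩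
      total (orders n) (λ _ → 1)                           ≡⟨ total-const (orders n) 1 ⟩
      N * 1                                                ≡⟨ *-identityʳ N ⟩
      N ∎
    expand : ∀ N x y c d → N * (x * d + y * c) ≡ N * x * d + N * y * c
    expand = solve-∀
    collect : ∀ c d x y → c * x * d + d * y * c ≡ c * d * (x + y)
    collect = solve-∀

  module _ {i j : ℕ} (i<j : i < j) (i+j≤s : i + j ≤ s) where

    private
      i+j≤n : i + j ≤ n
      i+j≤n = ≤-trans i+j≤s s≤n
      instance
        Ci≢0 : NonZero (n C i)
        Ci≢0 = >-nonZero (C-pos (m+n≤o⇒m≤o i i+j≤n))

      Ci≤Cj : n C i ≤ n C j
      Ci≤Cj with C-reflect i<j i+j≤n
      ... | inj₁ lt       = <⇒≤ lt
      ... | inj₂ (eq , _) = ≤-reflexive eq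

      distrib : (n C i) * (f i + f j) ≡ f i * (n C i) + f j * (n C i)
      distrib = trans (*-comm (n C i) _) (*-distribʳ-+ (n C i) (f i) (f j))

    -- In `cross` the weight `n C j` of `f i` may be lowered to `n C i`, which then cancels.
    pair-bound : f i + f j ≤ n C j
    pair-bound = *-cancelˡ-≤ (n C i) (begin
      (n C i) * (f i + f j)             ≡⟨ distrib ⟩
      f i * (n C i) + f j * (n C i)     ≤⟨ +-monoˡ-≤ _ (*-monoʳ-≤ (f i) Ci≤Cj) ⟩
      f i * (n C j) + f j * (n C i)     ≤⟨ cross i+j≤s ⟩
      (n C i) * (n C j) ∎)
      where open ≤-Reasoning

    -- If level `i` were inhabited, lowering its weight would lose something: the two coefficients
    -- agree only if i + j = n, which s < n forbids.
    pair-tight : s < n → f i + f j ≡ n C j → f i ≡ 0 × f j ≡ n C j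
    pair-tight s<n eq with f i in fi
    ... | zero  = refl , eq
    ... | suc a = contradiction (cross i+j≤s) (<⇒≱ (begin-strict
      (n C i) * (n C j)                  ≡⟨ cong ((n C i) *_) (trans (cong (_+ f j) fi) eq) ⟨
      (n C i) * (f i + f j)              ≡⟨ distrib ⟩
      f i * (n C i) + f j * (n C i)      <⟨ +-monoˡ-< _ (*-monoʳ-< (f i) {{subst NonZero (sym fi) _}} Ci<Cj) ⟩
      f i * (n C j) + f j * (n C i)      ∎))
      where
      open ≤-Reasoning
      Ci<Cj : n C i < n C j
      Ci<Cj with C-reflect i<j i+j≤n
      ... | inj₁ lt       = lt
      ... | inj₂ (_ , eq) = contradiction (≤-trans (≤-reflexive (sym eq)) i+j≤s) (<⇒≱ s<n)

  module EKR {k r : ℕ} (n≡ : n ≡ k + (r + k)) (2k≤s : k + k ≤ s) where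

    private
      k≤n : k ≤ n
      k≤n = subst (k ≤_) (sym n≡) (m≤m+n k _)

    X : Vec (Fin n) n → ℕ → ℕ
    X w j = φ (pull w (arc n k j))

    module Cyc {w : Vec (Fin n) n} (w∈ : w ∈ˡ orders n) where
      open Cycle k r (X w) (λ j → φ≤1 _)
        (λ j → cong (φ ∘ pull w) (subst (λ m → arc n k (j + m) ≡ arc n k j) n≡ (arc-periodic n k j)))
        (λ j {d} k≤d d≤ → pull-spread {w} {arc n k j} {arc n k (j + d)} w∈
          (subst (_≤ s) (sym (cong₂ _+_ (∣arc∣ n k k≤n j) (∣arc∣ n k k≤n (j + d)))) 2k≤s)
          (arc-disjoint n k j k≤d (subst (d + k ≤_) (sym (trans n≡ (sym (+-assoc k r k)))) (+-monoˡ-≤ k d≤))))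
        public

    private
      X≤k : ∀ {w} → w ∈ˡ orders n → range n (X w) ≤ k
      X≤k {w} w∈ = subst (λ m → range m (X w) ≤ k) (sym n≡) (Cyc.katona w∈)

      arcs : (n C k) * total (orders n) (λ w → range n (X w)) ≡ N * (n * f k)
      arcs = begin
        (n C k) * total (orders n) (λ w → range n (X w))
          ≡⟨ cong ((n C k) *_) (total-cong (orders n) (λ {w} _ → range≡total n (X w))) ⟩
        (n C k) * total (orders n) (λ w → total (upTo n) (X w))
          ≡⟨ cong ((n C k) *_) (total-swap (orders n) (upTo n) X) ⟩
        (n C k) * total (upTo n) (λ j → S (arc n k j))   ≡⟨ total-*ˡ (upTo n) (n C k) _ ⟨
        total (upTo n) (λ j → (n C k) * S (arc n k j))
          ≡⟨ total-cong (upTo n) (λ {j} _ → average-at (arc n k j) (∣arc∣ n k k≤n j)) ⟩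
        total (upTo n) (λ j → N * f k)                   ≡⟨ total-const (upTo n) _ ⟩
        length (upTo n) * (N * f k)                      ≡⟨ cong (_* (N * f k)) (length-upTo n) ⟩
        n * (N * f k)                                    ≡⟨ swap n N (f k) ⟩
        N * (n * f k) ∎
        where
        open ≡-Reasoning
        swap : ∀ n N x → n * (N * x) ≡ N * (n * x)
        swap = solve-∀

    -- Each order has at most `k` member arcs among `n`, so the density of the level is at most k /
    -- n. Absorption later turns this into C(n-1,k-1).
    ekr : n * f k ≤ k * (n C k)
    ekr = *-cancelˡ-≤ N (begin
      N * (n * f k)                                      ≡⟨ arcs ⟨
      (n C k) * total (orders n) (λ w → range n (X w))   ≤⟨ *-monoʳ-≤ (n C k) (total-mono (orders n) X≤k) ⟩
      (n C k) * total (orders n) (λ _ → k)               ≡⟨ cong ((n C k) *_) (total-const (orders n) k) ⟩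
      (n C k) * (N * k)                                  ≡⟨ swap (n C k) N k ⟩
      N * (k * (n C k)) ∎)
      where
      open ≤-Reasoning
      swap : ∀ c N k → c * (N * k) ≡ N * (k * c)
      swap = solve-∀

    ekr-tight : n * f k ≡ k * (n C k) → ∀ {w} → w ∈ˡ orders n → range (k + (r + k)) (X w) ≡ k
    ekr-tight eq {w} w∈ = subst (λ m → range m (X w) ≡ k) n≡
      (total-tight (orders n) X≤k (*-cancelˡ-≡ _ _ (n C k) {{>-nonZero (C-pos k≤n)}} (begin
        (n C k) * total (orders n) (λ w → range n (X w)) ≡⟨ arcs ⟩
        N * (n * f k)                        ≡⟨ cong (N *_) eq ⟩
        N * (k * (n C k))                    ≡⟨ swap (n C k) N k ⟨
        (n C k) * (N * k)                    ≡⟨ cong ((n C k) *_) (total-const (orders n) k) ⟨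
        (n C k) * total (orders n) (λ _ → k) ∎)) w∈)
      where
      open ≡-Reasoning
      swap : ∀ c N k → c * (N * k) ≡ N * (k * c)
      swap = solve-∀

-- Exchanges and the shape of an arc

transpose-left : ∀ {n} (i j : Fin n) → PC.transpose i j i ≡ j
transpose-left i j with i Fin.≟ i
... | yes _ = refl
... | no i≢i = contradiction refl i≢i

transpose-other : ∀ {n} (i j : Fin n) {e} → e ≢ i → e ≢ j → PC.transpose i j e ≡ e
transpose-other i j {e} e≢i e≢j with e Fin.≟ i
... | yes p = contradiction p e≢i
... | no _ with e Fin.≟ j
...   | yes p = contradiction p e≢j
...   | no _ = refl

transpose-swap : ∀ {n} (i j : Fin n) → PC.transpose i j j ≡ i
transpose-swap i j with j Fin.≟ i
... | yes p = p
... | no _ with j Fin.≟ j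
...   | yes _ = refl
...   | no j≢j = contradiction refl j≢j

outsider : ∀ {n} (A B : Subset n) → ∣ B ∣ ≤ ∣ A ∣ → A ≢ B → ∃[ e ] (e ∈ A × e ∉ B)
outsider A B le A≢B with Fin.any? (λ e → e ∈? A ×-dec ¬? (e ∈? B))
... | yes p = p
... | no none = contradiction (subset-ext A⊆B B⊆A) A≢B
  where
  A⊆B : ∀ {e} → e ∈ A → e ∈ B
  A⊆B {e} p = decidable-stable (e ∈? B) λ q → none (e , p , q)
  B⊆A : ∀ {e} → e ∈ B → e ∈ A
  B⊆A {e} p = decidable-stable (e ∈? A) λ q → <⇒≱ (p⊂q⇒∣p∣<∣q∣ (A⊆B , e , p , q)) le

∈-pull-order⁺ : ∀ {n} (π : Permutation′ n) {P e} → π ⟨$⟩ʳ e ∈ P → e ∈ pull (order π) P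
∈-pull-order⁺ π {P} {e} p = ∈-pull⁺ {w = order π} {P} (subst (_∈ P) (sym (lookup∘tabulate (π ⟨$⟩ʳ_) e)) p)

∈-pull-order⁻ : ∀ {n} (π : Permutation′ n) {P e} → e ∈ pull (order π) P → π ⟨$⟩ʳ e ∈ P
∈-pull-order⁻ π {P} {e} p = subst (_∈ P) (lookup∘tabulate (π ⟨$⟩ʳ_) e) (∈-pull⁻ {w = order π} {P} p)

module _ {n k : ℕ} .{{_ : NonZero n}} (k≤n : k ≤ n) (j : ℕ) where

  -- For j ≤ k an arc consists of an initial piece, p + j < k, and a wrapped final piece, p + j ≥ n;
  -- the positions between them are outside. The three lemmas of this module treat these cases.
  ∈-arc-low : ∀ {p : Fin n} → toℕ p + j < k → p ∈ arc n k j
  ∈-arc-low lt = ∈-setOf⁺ (arc? n k j ∘ toℕ) (subst (_< k) (sym (m<n⇒m%n≡m (<-≤-trans lt k≤n))) lt)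

  ∈-arc-high : ∀ {p : Fin n} → j ≤ k → n ≤ toℕ p + j → p ∈ arc n k j
  ∈-arc-high {p} j≤k n≤ = ∈-setOf⁺ (arc? n k j ∘ toℕ) (subst (_< k) (sym reduce) q<k)
    where
    q = toℕ p + j ∸ n
    q<k : q < k
    q<k = <-≤-trans (+-cancelʳ-< n q j (subst₂ _<_ (sym (m∸n+n≡m n≤)) (+-comm n j) (+-monoˡ-< j (Fin.toℕ<n p)))) j≤k
    reduce : (toℕ p + j) % n ≡ q
    reduce = begin
      (toℕ p + j) % n ≡⟨ cong (_% n) (m∸n+n≡m n≤) ⟨
      (q + n) % n     ≡⟨ [m+n]%n≡m%n q n ⟩
      q % n           ≡⟨ m<n⇒m%n≡m (<-≤-trans q<k k≤n) ⟩
      q ∎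
      where open ≡-Reasoning

  ∉-arc : ∀ {p : Fin n} → k ≤ toℕ p + j → toℕ p + j < n → p ∉ arc n k j
  ∉-arc {p} k≤ <n q = <⇒≱ (∈-setOf⁻ (arc? n k j ∘ toℕ) q) (subst (k ≤_) (sym (m<n⇒m%n≡m <n)) k≤)

-- The rotation by `j` is undone by the rotation by `c`, since `j + c` is a multiple of `n`.
rotation-injective : ∀ {n} .{{_ : NonZero n}} j {a b} → a < n → b < n → (a + j) % n ≡ (b + j) % n → a ≡ b
rotation-injective {n} j {a} {b} a<n b<n eq = trans (sym (back a<n)) (trans (cong (λ v → (v + c) % n) eq) (back b<n))
  where
  open ≡-Reasoning
  c = n ∸ j % n
  j+c : j + c ≡ n + (j / n) * n
  j+c = begin
    j + c                         ≡⟨ cong (_+ c) (m≡m%n+[m/n]*n j n) ⟩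
    j % n + (j / n) * n + c       ≡⟨ swap (j % n) ((j / n) * n) c ⟩
    j % n + c + (j / n) * n       ≡⟨ cong (_+ (j / n) * n) (m+[n∸m]≡n (m%n≤n j n)) ⟩
    n + (j / n) * n ∎
    where
    swap : ∀ x y z → x + y + z ≡ x + z + y
    swap = solve-∀
  back : ∀ {a} → a < n → ((a + j) % n + c) % n ≡ a
  back {a} a<n = begin
    ((a + j) % n + c) % n         ≡⟨ %-distribˡ-+ ((a + j) % n) c n ⟩
    ((a + j) % n % n + c % n) % n ≡⟨ cong (λ z → (z + c % n) % n) (m%n%n≡m%n (a + j) n) ⟩
    ((a + j) % n + c % n) % n     ≡⟨ %-distribˡ-+ (a + j) c n ⟨
    (a + j + c) % n               ≡⟨ cong (_% n) (trans (+-assoc a j c) (cong (a +_) j+c)) ⟩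
    (a + (n + (j / n) * n)) % n   ≡⟨ cong (_% n) (+-assoc a n _) ⟨
    (a + n + (j / n) * n) % n     ≡⟨ [m+kn]%n≡m%n (a + n) (j / n) n ⟩
    (a + n) % n                   ≡⟨ [m+n]%n≡m%n a n ⟩
    a % n                         ≡⟨ m<n⇒m%n≡m a<n ⟩
    a ∎

-- Realising sets as arcs of an order

module _ {n : ℕ} (col : Fin n → ℕ) where

  superlevel : ℕ → ℕ
  superlevel t = total (allFin n) (λ e → ind (t <? col e))

  sublevel+superlevel : ∀ t → sublevel col t + superlevel t ≡ n
  sublevel+superlevel t = begin
    sublevel col t + superlevel t ≡⟨ total-+ (allFin n) _ _ ⟨
    total (allFin n) (λ e → ind (col e ≤? t) + ind (t <? col e)) ≡⟨ total-cong (allFin n) (λ {e} _ → one (col e)) ⟩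
    total (allFin n) (λ _ → 1) ≡⟨ total-const (allFin n) 1 ⟩
    length (allFin n) * 1      ≡⟨ *-identityʳ _ ⟩
    length (allFin n)          ≡⟨ length-tabulate {n = n} id ⟩
    n ∎
    where
    open ≡-Reasoning
    one : ∀ c → ind (c ≤? t) + ind (t <? c) ≡ 1
    one c with <-≤-connex t c
    ... | inj₁ t<c = cong₂ _+_ (ind-no (c ≤? t) (<⇒≱ t<c)) (ind-yes (t <? c) t<c)
    ... | inj₂ c≤t = cong₂ _+_ (ind-yes (c ≤? t) c≤t) (ind-no (t <? c) (≤⇒≯ c≤t))

-- Membership in `S` agrees with having a colour outside (a, b]. The colour is a separate argument
-- so that it can be a numeral in each case of a colouring.
Around : ∀ {n} → Subset n → (a b c : ℕ) → Fin n → Set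
Around S a b c e = (e ∈ S × (c ≤ a ⊎ b < c)) ⊎ (e ∉ S × (a < c × c ≤ b))

-- In the order by colour the colours outside (a, b] form a cyclic interval.
module _ {n k : ℕ} .{{_ : NonZero n}} (k≤n : k ≤ n) (col : Fin n → ℕ) {a b : ℕ} (a≤b : a ≤ b)
         {S : Subset n} (∣S∣ : ∣ S ∣ ≡ k) (around : ∀ e → Around S a b (col e) e) where

  private
    j = superlevel col b

  -- The colours up to `a` fill the first positions and those above `b` the last `j`. Together they
  -- are `S`, which is why the arc sits at step `j`.
  ends : sublevel col a + j ≡ k
  ends = begin
    sublevel col a + j ≡⟨ total-+ (allFin n) _ _ ⟨
    total (allFin n) (λ e → ind (col e ≤? a) + ind (b <? col e)) ≡⟨ total-cong (allFin n) (λ {e} _ → member (around e)) ⟩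
    total (allFin n) (λ e → ind (e ∈? S)) ≡⟨ ∣∣≡total S ⟨
    ∣ S ∣ ≡⟨ ∣S∣ ⟩
    k ∎
    where
    open ≡-Reasoning
    member : ∀ {c e} → Around S a b c e → ind (c ≤? a) + ind (b <? c) ≡ ind (e ∈? S)
    member {c} {e} (inj₁ (e∈ , inj₁ c≤a)) = trans (cong₂ _+_ (ind-yes (c ≤? a) c≤a) (ind-no (b <? c) (≤⇒≯ (≤-trans c≤a a≤b)))) (sym (ind-yes (e ∈? S) e∈))
    member {c} {e} (inj₁ (e∈ , inj₂ b<c)) = trans (cong₂ _+_ (ind-no (c ≤? a) (<⇒≱ (≤-<-trans a≤b b<c))) (ind-yes (b <? c) b<c)) (sym (ind-yes (e ∈? S) e∈))
    member {c} {e} (inj₂ (e∉ , a<c , c≤b)) = trans (cong₂ _+_ (ind-no (c ≤? a) (<⇒≱ a<c)) (ind-no (b <? c) (≤⇒≯ c≤b))) (sym (ind-no (e ∈? S) e∉))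

  place : pull (order (ranking col)) (arc n k j) ≡ S
  place = subset-ext (λ {e} p → bwd (around e) (∈-pull-order⁻ (ranking col) p)) (λ {e} p → ∈-pull-order⁺ (ranking col) (fwd p (around e)))
    where
    j≤k : j ≤ k
    j≤k = subst (j ≤_) ends (m≤n+m j _)
    fwd : ∀ {e} → e ∈ S → Around S a b (col e) e → ranking col ⟨$⟩ʳ e ∈ arc n k j
    fwd {e} p (inj₁ (_ , inj₁ c≤a)) = ∈-arc-low k≤n j (subst (toℕ (ranking col ⟨$⟩ʳ e) + j <_) ends (+-monoˡ-< j (ranking-≤ col {e} c≤a)))
    fwd {e} p (inj₁ (_ , inj₂ b<c)) = ∈-arc-high k≤n j j≤k (subst (_≤ toℕ (ranking col ⟨$⟩ʳ e) + j) (sublevel+superlevel col b) (+-monoˡ-≤ j (ranking-> col {e} b<c)))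
    fwd p (inj₂ (q , _)) = contradiction p q
    bwd : ∀ {e} → Around S a b (col e) e → ranking col ⟨$⟩ʳ e ∈ arc n k j → e ∈ S
    bwd (inj₁ (p , _)) _ = p
    bwd {e} (inj₂ (_ , a<c , c≤b)) q = contradiction q (∉-arc k≤n j
      (subst (_≤ toℕ (ranking col ⟨$⟩ʳ e) + j) ends (+-monoˡ-≤ j (ranking-> col {e} a<c)))
      (subst (toℕ (ranking col ⟨$⟩ʳ e) + j <_) (sublevel+superlevel col b) (+-monoˡ-< j (ranking-≤ col {e} c≤b))))

-- Equality in the Erdős-Ko-Rado bound

module Uniqueness {n s : ℕ} .{{_ : NonZero n}} (s≤n : s ≤ n) (φ : Subset n → ℕ) (φ≤1 : ∀ A → φ A ≤ 1)
                  (spread : ∀ {A B} → ∣ A ∣ + ∣ B ∣ ≤ s → (∀ {e} → e ∈ A → e ∉ B) → φ A + φ B ≤ 1)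
                  {k r : ℕ} (n≡ : n ≡ k + (r + k)) (2k≤s : k + k ≤ s) (0<k : 0 < k) (0<r : 0 < r)
                  (tight : n * level n φ k ≡ k * (n C k)) where

  open Spread s≤n φ φ≤1 spread
  open EKR {k} {r} n≡ 2k≤s

  private
    k≤n : k ≤ n
    k≤n = subst (k ≤_) (sym n≡) (m≤m+n k _)

    -- Steps 1, ..., k run through all k-arcs containing the last position, so one well-placed order
    -- certifies many members.
    consecutive : ∀ π → X (order π) 0 ≡ 0 → X (order π) 1 ≡ 1 → ∀ j → j < k → X (order π) (suc j) ≡ 1
    consecutive π = Cyc.Tight.run w∈ 0<r 0<k (ekr-tight tight w∈)
      where w∈ = ∈-order π

  private
    le! : ∀ {m n} {_ : True (m ≤? n)} → m ≤ n
    le! {_} {_} {t} = toWitness t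

    low : ∀ {S : Subset n} {a b c e} → e ∈ S → {_ : True (c ≤? a)} → Around S a b c e
    low p {t} = inj₁ (p , inj₁ (toWitness t))

    high : ∀ {S : Subset n} {a b c e} → e ∈ S → {_ : True (b <? c)} → Around S a b c e
    high p {t} = inj₁ (p , inj₂ (toWitness t))

    mid : ∀ {S : Subset n} {a b c e} → e ∉ S → {_ : True (a <? c)} → {_ : True (c ≤? b)} → Around S a b c e
    mid p {t} {u} = inj₂ (p , toWitness t , toWitness u)

  -- A′ = A − x + y.
  record Exit (x y : Fin n) : Set where
    field
      {A A′}   : Subset n
      ∣A∣      : ∣ A ∣ ≡ k
      ∣A′∣     : ∣ A′ ∣ ≡ k
      A∈F      : φ A ≡ 1
      A′∉F     : φ A′ ≡ 0
      x∈A      : x ∈ A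
      x∉A′     : x ∉ A′
      y∈A′     : y ∈ A′
      y∉A      : y ∉ A
      A⇒A′     : ∀ {e} → e ≢ x → e ∈ A → e ∈ A′
      A′⇒A     : ∀ {e} → e ≢ y → e ∈ A′ → e ∈ A

  -- Order the elements as A ∩ B − x, A \ B, y, the rest, B \ A, x.  Then A′, A
  -- and B are arcs starting at successive steps 0, 1 and 1 ≤ j ≤ k.
  avoiding-y : ∀ {x y} → Exit x y → ∀ {B} → ∣ B ∣ ≡ k → x ∈ B → y ∉ B → φ B ≡ 1
  avoiding-y {x} {y} exit {B} ∣B∣ x∈B y∉B = finish (superlevel col 3) at-B 1≤j j≤k
    where
    open Exit exit

    colour : ∀ {e} → Dec (e ≡ x) → Dec (e ≡ y) → Dec (e ∈ A) → Dec (e ∈ B) → ℕ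
    colour (yes _) _       _       _       = 5
    colour (no _)  (yes _) _       _       = 2
    colour (no _)  (no _)  (yes _) (yes _) = 0
    colour (no _)  (no _)  (yes _) (no _)  = 1
    colour (no _)  (no _)  (no _)  (yes _) = 4
    colour (no _)  (no _)  (no _)  (no _)  = 3

    col : Fin n → ℕ
    col e = colour (e Fin.≟ x) (e Fin.≟ y) (e ∈? A) (e ∈? B)

    classify : ∀ {e} dx dy dA dB → let c = colour {e} dx dy dA dB in
               Around A′ 2 5 c e × Around A 1 4 c e × Around B 0 3 c e
    classify (yes refl) _ _ _ = mid x∉A′ , high x∈A , high x∈B
    classify (no _) (yes refl) _ _ = low y∈A′ , mid y∉A , mid y∉B
    classify (no e≢x) (no _) (yes p) (yes q) = low (A⇒A′ e≢x p) , low p , low q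
    classify (no e≢x) (no _) (yes p) (no q)  = low (A⇒A′ e≢x p) , low p , mid q
    classify (no _) (no e≢y) (no p) (yes q)  = mid (p ∘ A′⇒A e≢y) , mid p , high q
    classify (no _) (no e≢y) (no p) (no q)   = mid (p ∘ A′⇒A e≢y) , mid p , mid q

    class : ∀ e → Around A′ 2 5 (col e) e × Around A 1 4 (col e) e × Around B 0 3 (col e) e
    class e = classify (e Fin.≟ x) (e Fin.≟ y) (e ∈? A) (e ∈? B)

    colour≤5 : ∀ {e} dx dy dA dB → colour {e} dx dy dA dB ≤ 5
    colour≤5 (yes _) _       _       _       = le!
    colour≤5 (no _)  (yes _) _       _       = le!
    colour≤5 (no _)  (no _)  (yes _) (yes _) = le!
    colour≤5 (no _)  (no _)  (yes _) (no _)  = le!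
    colour≤5 (no _)  (no _)  (no _)  (yes _) = le!
    colour≤5 (no _)  (no _)  (no _)  (no _)  = le!

    col-x : col x ≡ 5
    col-x = lemma (x Fin.≟ x)
      where
      lemma : ∀ (d : Dec (x ≡ x)) → colour d (x Fin.≟ y) (x ∈? A) (x ∈? B) ≡ 5
      lemma (yes _) = refl
      lemma (no ¬p) = contradiction refl ¬p

    colour≤4 : ∀ {e} → e ≢ x → ∀ dx dy dA dB → colour {e} dx dy dA dB ≤ 4
    colour≤4 e≢x (yes p) _       _       _       = contradiction p e≢x
    colour≤4 e≢x (no _)  (yes _) _       _       = le!
    colour≤4 e≢x (no _)  (no _)  (yes _) (yes _) = le!
    colour≤4 e≢x (no _)  (no _)  (yes _) (no _)  = le!
    colour≤4 e≢x (no _)  (no _)  (no _)  (yes _) = le!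
    colour≤4 e≢x (no _)  (no _)  (no _)  (no _)  = le!

    -- The step of an arc is the number of colours above its band. The bands (2,5], (1,4] and (0,3]
    -- of `A′`, `A` and `B` leave nothing, only `x`, and `x` with the rest of `B` outside `A` above
    -- them.
    above-5 : superlevel col 5 ≡ 0
    above-5 = total-0 (allFin n) (λ {e} _ → ind-no (5 <? col e)
      (≤⇒≯ (colour≤5 (e Fin.≟ x) (e Fin.≟ y) (e ∈? A) (e ∈? B))))

    above-4 : superlevel col 4 ≡ 1
    above-4 = trans (total-single {f = λ e → ind (4 <? col e)} (Unique.allFin⁺ n) (∈-allFin x)
                      (λ {e} e≢x → ind-no (4 <? col e)
                        (≤⇒≯ (colour≤4 e≢x (e Fin.≟ x) (e Fin.≟ y) (e ∈? A) (e ∈? B)))))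
                    (cong (λ c → ind (4 <? c)) col-x)

    1≤j : 1 ≤ superlevel col 3
    1≤j = subst (_≤ superlevel col 3) (cong (λ c → ind (3 <? c)) col-x) (term≤total (λ e → ind (3 <? col e)) (∈-allFin x))

    π = ranking col

    at-A′ : X (order π) 0 ≡ 0
    at-A′ = trans (cong (X (order π)) (sym above-5))
      (trans (cong φ (place k≤n col (m≤m+n 2 3) ∣A′∣ (λ e → proj₁ (class e)))) A′∉F)

    at-A : X (order π) 1 ≡ 1
    at-A = trans (cong (X (order π)) (sym above-4))
      (trans (cong φ (place k≤n col (m≤m+n 1 3) ∣A∣ (λ e → proj₁ (proj₂ (class e))))) A∈F)

    at-B : X (order π) (superlevel col 3) ≡ φ B
    at-B = cong φ (place k≤n col z≤n ∣B∣ (λ e → proj₂ (proj₂ (class e))))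

    j≤k : superlevel col 3 ≤ k
    j≤k = subst (superlevel col 3 ≤_) (ends k≤n col z≤n ∣B∣ (λ e → proj₂ (proj₂ (class e)))) (m≤n+m _ (sublevel col 0))

    finish : ∀ j → X (order π) j ≡ φ B → 1 ≤ j → j ≤ k → φ B ≡ 1
    finish (suc j) eq _ j<k = trans (sym eq) (consecutive π at-A′ at-A j j<k)

  -- For z ∉ B, order the elements as the rest, z, y, B − x − y, x.  The arc at
  -- step 1 is a member by avoiding-y, the one at step 0 is not as it is disjoint
  -- from the member B − y + z, hence B, the arc at step k, is a member.
  containing-y : ∀ {x y} → Exit x y → ∀ {B} → ∣ B ∣ ≡ k → x ∈ B → y ∈ B → φ B ≡ 1
  containing-y {x} {y} exit {B} ∣B∣ x∈B y∈B = finish (pred k) (suc-pred k {{>-nonZero 0<k}})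
    where
    open Exit exit

    x≢y : x ≢ y
    x≢y refl = y∉A x∈A

    spare : ∃[ e ] e ∉ B
    spare with Fin.any? (λ e → ¬? (e ∈? B))
    ... | yes p = p
    ... | no none = contradiction full (<⇒≢ k<n ∘ trans (sym ∣B∣))
      where
      k<n : k < n
      k<n = subst (k <_) (sym n≡) (m<m+n k (≤-trans 0<r (m≤m+n r k)))
      full : ∣ B ∣ ≡ n
      full = trans (∣∣≡total B) (trans (total-cong (allFin n) (λ {e} _ → ind-yes (e ∈? B)
        (decidable-stable (e ∈? B) (λ q → none (e , q)))))
        (trans (total-const (allFin n) 1) (trans (*-identityʳ _) (length-tabulate {n = n} id))))

    z = proj₁ spare
    z∉B = proj₂ spare

    colour : ∀ {e} → Dec (e ≡ x) → Dec (e ≡ y) → Dec (e ∈ B) → Dec (e ≡ z) → ℕ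
    colour (yes _) _       _       _       = 5
    colour (no _)  (yes _) _       _       = 3
    colour (no _)  (no _)  (yes _) _       = 4
    colour (no _)  (no _)  (no _)  (yes _) = 2
    colour (no _)  (no _)  (no _)  (no _)  = 1

    col : Fin n → ℕ
    col e = colour (e Fin.≟ x) (e Fin.≟ y) (e ∈? B) (e Fin.≟ z)

    π = ranking col

    pos : Fin n → ℕ
    pos e = toℕ (π ⟨$⟩ʳ e)

    around : ∀ e → Around B 0 2 (col e) e
    around e = lemma (e Fin.≟ x) (e Fin.≟ y) (e ∈? B) (e Fin.≟ z)
      where
      lemma : ∀ {e} dx dy dB dz → Around B 0 2 (colour {e} dx dy dB dz) e
      lemma (yes refl) _          _       _       = high x∈B
      lemma (no _)     (yes refl) _       _       = high y∈B
      lemma (no _)     (no _)     (yes p) _       = high p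
      lemma (no _)     (no _)     (no p)  (yes _) = mid p
      lemma (no _)     (no _)     (no p)  (no _)  = mid p

    col≥1 : ∀ e → 1 ≤ col e
    col≥1 e = lemma (e Fin.≟ x) (e Fin.≟ y) (e ∈? B) (e Fin.≟ z)
      where
      lemma : ∀ {e} dx dy dB dz → 1 ≤ colour {e} dx dy dB dz
      lemma (yes _) _       _       _       = le!
      lemma (no _)  (yes _) _       _       = le!
      lemma (no _)  (no _)  (yes _) _       = le!
      lemma (no _)  (no _)  (no _)  (yes _) = le!
      lemma (no _)  (no _)  (no _)  (no _)  = le!

    col-x : col x ≡ 5
    col-x = lemma (x Fin.≟ x)
      where
      lemma : ∀ (d : Dec (x ≡ x)) → colour d (x Fin.≟ y) (x ∈? B) (x Fin.≟ z) ≡ 5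
      lemma (yes _) = refl
      lemma (no ¬p) = contradiction refl ¬p

    col-other : ∀ {e} → e ≢ x → col e ≤ 4
    col-other {e} e≢x = lemma (e Fin.≟ x) (e Fin.≟ y) (e ∈? B) (e Fin.≟ z)
      where
      lemma : ∀ dx dy dB dz → colour {e} dx dy dB dz ≤ 4
      lemma (yes p) _       _       _       = contradiction p e≢x
      lemma (no _)  (yes _) _       _       = le!
      lemma (no _)  (no _)  (yes _) _       = le!
      lemma (no _)  (no _)  (no _)  (yes _) = le!
      lemma (no _)  (no _)  (no _)  (no _)  = le!

    col-y : col y ≡ 3
    col-y = lemma (y Fin.≟ x) (y Fin.≟ y)
      where
      lemma : ∀ dx dy → colour {y} dx dy (y ∈? B) (y Fin.≟ z) ≡ 3
      lemma (yes p) _       = contradiction (sym p) x≢y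
      lemma (no _)  (yes _) = refl
      lemma (no _)  (no ¬p) = contradiction refl ¬p

    col-gap : ∀ {e} → e ≢ z → col e ≤ 1 ⊎ 2 < col e
    col-gap {e} e≢z = lemma (e Fin.≟ x) (e Fin.≟ y) (e ∈? B) (e Fin.≟ z)
      where
      lemma : ∀ dx dy dB dz → colour {e} dx dy dB dz ≤ 1 ⊎ 2 < colour {e} dx dy dB dz
      lemma (yes _) _       _       _       = inj₂ le!
      lemma (no _)  (yes _) _       _       = inj₂ le!
      lemma (no _)  (no _)  (yes _) _       = inj₂ le!
      lemma (no _)  (no _)  (no _)  (yes p) = contradiction p e≢z
      lemma (no _)  (no _)  (no _)  (no _)  = inj₁ le!

    z-late : 1 < col z
    z-late = lemma (z Fin.≟ x) (z Fin.≟ y) (z ∈? B) (z Fin.≟ z)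
      where
      lemma : ∀ dx dy dB dz → 1 < colour {z} dx dy dB dz
      lemma (yes _) _       _       _       = le!
      lemma (no _)  (yes _) _       _       = le!
      lemma (no _)  (no _)  (yes _) _       = le!
      lemma (no _)  (no _)  (no _)  (yes _) = le!
      lemma (no _)  (no _)  (no _)  (no ¬p) = contradiction refl ¬p

    above-4 : superlevel col 4 ≡ 1
    above-4 = trans (total-single {f = λ e → ind (4 <? col e)} (Unique.allFin⁺ n) (∈-allFin x)
                      (λ {e} e≢x → ind-no (4 <? col e) (≤⇒≯ (col-other e≢x))))
                    (cong (λ c → ind (4 <? c)) col-x)

    above-2 : superlevel col 2 ≡ k
    above-2 = trans (cong (_+ superlevel col 2) (sym nothing)) (ends k≤n col z≤n ∣B∣ around)
      where
      nothing : sublevel col 0 ≡ 0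
      nothing = total-0 (allFin n) (λ {e} _ → ind-no (col e ≤? 0) (<⇒≱ (col≥1 e)))

    below-2 : sublevel col 2 ≡ k + r
    below-2 = +-cancelʳ-≡ k _ _ (begin
      sublevel col 2 + k                ≡⟨ cong (sublevel col 2 +_) above-2 ⟨
      sublevel col 2 + superlevel col 2 ≡⟨ sublevel+superlevel col 2 ⟩
      n                                 ≡⟨ n≡ ⟩
      k + (r + k)                       ≡⟨ +-assoc k r k ⟨
      k + r + k                         ∎)
      where open ≡-Reasoning

    -- The complement of `B` has k + r elements and colour 1 omits only `z` from it. As r > 0, the
    -- first `k` positions hold neither `z` nor an element of `B`, so the arc at step 0 misses `B′`.
    below-1 : k ≤ sublevel col 1
    below-1 = +-cancelʳ-≤ 1 _ _ (begin
      k + 1                    ≤⟨ +-monoʳ-≤ k 0<r ⟩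
      k + r                    ≡⟨ below-2 ⟨
      sublevel col 2           ≤⟨ total-mono (allFin n) (λ {e} _ → step e (e Fin.≟ z)) ⟩
      total (allFin n) (λ e → ind (col e ≤? 1) + ind (e Fin.≟ z)) ≡⟨ total-+ (allFin n) _ _ ⟩
      sublevel col 1 + total (allFin n) (λ e → ind (e Fin.≟ z))
        ≡⟨ cong (sublevel col 1 +_) (trans (total-single {f = λ e → ind (e Fin.≟ z)} (Unique.allFin⁺ n) (∈-allFin z)
             (λ {e} e≢z → ind-no (e Fin.≟ z) e≢z)) (ind-yes (z Fin.≟ z) refl)) ⟩
      sublevel col 1 + 1       ∎)
      where
      open ≤-Reasoning
      step : ∀ e (d : Dec (e ≡ z)) → ind (col e ≤? 2) ≤ ind (col e ≤? 1) + ind d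
      step e (yes _) = ≤-trans (ind≤1 (col e ≤? 2)) (m≤n+m 1 _)
      step e (no e≢z) with col-gap e≢z
      ... | inj₁ le = ≤-trans (ind≤1 (col e ≤? 2)) (≤-trans (≤-reflexive (sym (ind-yes (col e ≤? 1) le))) (m≤m+n _ 0))
      ... | inj₂ lt = ≤-trans (≤-reflexive (ind-no (col e ≤? 2) (<⇒≱ lt))) z≤n

    at-B : X (order π) k ≡ φ B
    at-B = trans (cong (X (order π)) (sym above-2)) (cong φ (place k≤n col z≤n ∣B∣ around))

    ∣Q∣ : ∀ j → ∣ pull (order π) (arc n k j) ∣ ≡ k
    ∣Q∣ j = trans (∣pull∣ (∈-order π) (arc n k j)) (∣arc∣ n k k≤n j)

    x-last : n ≤ pos x + 1
    x-last = begin
      n                                 ≡⟨ sublevel+superlevel col 4 ⟨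
      sublevel col 4 + superlevel col 4 ≡⟨ cong (sublevel col 4 +_) above-4 ⟩
      sublevel col 4 + 1                ≤⟨ +-monoˡ-≤ 1 (ranking-> col {x} (≤-reflexive (sym col-x))) ⟩
      pos x + 1                         ∎
      where open ≤-Reasoning

    at-1 : X (order π) 1 ≡ 1
    at-1 = avoiding-y exit (∣Q∣ 1)
      (∈-pull-order⁺ π {arc n k 1} (∈-arc-high k≤n 1 0<k x-last))
      (∉-arc k≤n 1 (≤-trans k≤y (m≤m+n _ 1)) y<x ∘ ∈-pull-order⁻ π {arc n k 1})
      where
      open ≤-Reasoning
      k≤y : k ≤ pos y
      k≤y = begin
        k              ≤⟨ m≤m+n k r ⟩
        k + r          ≡⟨ below-2 ⟨
        sublevel col 2 ≤⟨ ranking-> col {y} (≤-reflexive (sym col-y)) ⟩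
        pos y          ∎
      y<x : pos y + 1 < n
      y<x = begin-strict
        pos y + 1      ≡⟨ +-comm (pos y) 1 ⟩
        suc (pos y)    ≤⟨ ranking-≤ col {y} (≤-reflexive col-y) ⟩
        sublevel col 3 ≤⟨ ranking-> col {x} (subst (3 <_) (sym col-x) le!) ⟩
        pos x          <⟨ Fin.toℕ<n (π ⟨$⟩ʳ x) ⟩
        n              ∎

    -- This is B - y + z. It contains `x` but not `y`, so `avoiding-y` applies; as an image under a
    -- transposition it has the size of `B`.
    B′ : Subset n
    B′ = image (transpose y z) B

    B′∈F : φ B′ ≡ 1
    B′∈F = avoiding-y exit (trans (∣image∣ (transpose y z) B) ∣B∣)
      (∈-image⁺ (transpose y z) (subst (_∈ B) (sym (transpose-other z y (λ x≡z → z∉B (subst (_∈ B) x≡z x∈B)) x≢y)) x∈B))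
      (λ p → z∉B (subst (_∈ B) (transpose-swap z y) (∈-image⁻ (transpose y z) p)))

    disjoint : ∀ {e} → e ∈ pull (order π) (arc n k 0) → e ∉ B′
    disjoint {e} p q = late (e Fin.≟ z) (e Fin.≟ y)
      where
      early : ¬ k ≤ pos e
      early le = ∉-arc k≤n 0 (subst (k ≤_) (sym (+-identityʳ _)) le)
        (subst (_< n) (sym (+-identityʳ _)) (Fin.toℕ<n (π ⟨$⟩ʳ e))) (∈-pull-order⁻ π {arc n k 0} p)
      e∈ : PC.transpose z y e ∈ B
      e∈ = ∈-image⁻ (transpose y z) q
      late : Dec (e ≡ z) → Dec (e ≡ y) → ⊥
      late (yes e≡z) _        = early (subst (λ d → k ≤ pos d) (sym e≡z) (≤-trans below-1 (ranking-> col {z} z-late)))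
      late (no _)   (yes e≡y) = z∉B (subst (_∈ B) (trans (cong (PC.transpose z y) e≡y) (transpose-swap z y)) e∈)
      late (no e≢z) (no e≢y)  = early (≤-trans (≤-trans (m≤m+n k r) (≤-reflexive (sym below-2))) (ranking-> col {e} (inB (around e))))
        where
        inB : Around B 0 2 (col e) e → 2 < col e
        inB (inj₁ (_ , inj₁ le)) = contradiction (col≥1 e) (≤⇒≯ le)
        inB (inj₁ (_ , inj₂ lt)) = lt
        inB (inj₂ (∉ , _))       = contradiction (subst (_∈ B) (transpose-other z y e≢z e≢y) e∈) ∉

    at-0 : X (order π) 0 ≡ 0
    at-0 = n≤0⇒n≡0 (s≤s⁻¹ (subst (_≤ 1) (trans (cong (X (order π) 0 +_) B′∈F) (+-comm _ 1))
      (spread (subst (_≤ s) (sym (cong₂ _+_ (∣Q∣ 0) (trans (∣image∣ (transpose y z) B) ∣B∣))) 2k≤s) disjoint)))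

    finish : ∀ k′ → suc k′ ≡ k → φ B ≡ 1
    finish k′ refl = trans (sym at-B) (consecutive π at-0 at-1 k′ ≤-refl)

  -- One step raises every residue by one, so the arc gains only the residue n - 1 and loses only k
  -- - 1. Rotation is injective, so each residue belongs to a single element, `x` and `y`
  -- respectively.
  exit-at : ∀ j → X (order Data.Fin.Permutation.id) j ≡ 0 → X (order Data.Fin.Permutation.id) (suc j) ≡ 1 →
            ∃[ x ] ∃[ y ] Exit x y
  exit-at j out in′ = x , y , record
    { ∣A∣ = ∣window∣ (suc j) ; ∣A′∣ = ∣window∣ j ; A∈F = in′ ; A′∉F = out
    ; x∈A = x∈A ; x∉A′ = x∉A′ ; y∈A′ = y∈A′ ; y∉A = y∉A
    ; A⇒A′ = λ {e} e≢x p → decidable-stable (e ∈? A′) λ q → e≢x (same (trans (leaves p q) (sym (leaves x∈A x∉A′))))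
    ; A′⇒A = λ {e} e≢y p → decidable-stable (e ∈? A) λ q → e≢y (same (trans (enters p q) (sym (enters y∈A′ y∉A))))
    }
    where
    w∈ = ∈-order {n} Data.Fin.Permutation.id
    window : ℕ → Subset n
    window j = pull (order Data.Fin.Permutation.id) (arc n k j)
    A  = window (suc j)
    A′ = window j

    ∣window∣ : ∀ j → ∣ window j ∣ ≡ k
    ∣window∣ j = trans (∣pull∣ w∈ (arc n k j)) (∣arc∣ n k k≤n j)

    differ : A ≢ A′
    differ eq = contradiction (trans (sym out) (trans (cong φ (sym eq)) in′)) λ ()

    A\A′ = outsider A A′ (≤-reflexive (trans (∣window∣ j) (sym (∣window∣ (suc j))))) differ
    A′\A = outsider A′ A (≤-reflexive (trans (∣window∣ (suc j)) (sym (∣window∣ j)))) (differ ∘ sym)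
    x = proj₁ A\A′
    x∈A = proj₁ (proj₂ A\A′)
    x∉A′ = proj₂ (proj₂ A\A′)
    y = proj₁ A′\A
    y∈A′ = proj₁ (proj₂ A′\A)
    y∉A = proj₂ (proj₂ A′\A)

    k<n : k < n
    k<n = subst (k <_) (sym n≡) (m<m+n k (≤-trans 0<r (m≤m+n r k)))

    v : Fin n → ℕ
    v e = (toℕ e + j) % n

    v<n : ∀ e → v e < n
    v<n e = m%n<n (toℕ e + j) n

    same : ∀ {a b} → suc (v a) ≡ suc (v b) → a ≡ b
    same {a} {b} eq = Fin.toℕ-injective (rotation-injective j (Fin.toℕ<n a) (Fin.toℕ<n b) (suc-injective eq))

    v-suc : ∀ e → (toℕ e + suc j) % n ≡ suc (v e) % n
    v-suc e = begin
      (toℕ e + suc j) % n       ≡⟨ cong (_% n) (trans (+-suc (toℕ e) j) (+-comm 1 _)) ⟩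
      (toℕ e + j + 1) % n       ≡⟨ %-distribˡ-+ (toℕ e + j) 1 n ⟩
      (v e + 1 % n) % n         ≡⟨ cong (λ z → (z + 1 % n) % n) (m%n%n≡m%n (toℕ e + j) n) ⟨
      (v e % n + 1 % n) % n     ≡⟨ %-distribˡ-+ (v e) 1 n ⟨
      (v e + 1) % n             ≡⟨ cong (_% n) (+-comm (v e) 1) ⟩
      suc (v e) % n             ∎
      where open ≡-Reasoning

    ∈A′⁺ : ∀ {e} → v e < k → e ∈ A′
    ∈A′⁺ lt = ∈-pull-order⁺ Data.Fin.Permutation.id (∈-setOf⁺ (arc? n k j ∘ toℕ) lt)
    ∈A′⁻ : ∀ {e} → e ∈ A′ → v e < k
    ∈A′⁻ p = ∈-setOf⁻ (arc? n k j ∘ toℕ) (∈-pull-order⁻ Data.Fin.Permutation.id {arc n k j} p)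
    ∈A⁺ : ∀ {e} → suc (v e) % n < k → e ∈ A
    ∈A⁺ {e} lt = ∈-pull-order⁺ Data.Fin.Permutation.id (∈-setOf⁺ (arc? n k (suc j) ∘ toℕ) (subst (_< k) (sym (v-suc e)) lt))
    ∈A⁻ : ∀ {e} → e ∈ A → suc (v e) % n < k
    ∈A⁻ {e} p = subst (_< k) (v-suc e) (∈-setOf⁻ (arc? n k (suc j) ∘ toℕ) (∈-pull-order⁻ Data.Fin.Permutation.id {arc n k (suc j)} p))

    leaves : ∀ {e} → e ∈ A → e ∉ A′ → suc (v e) ≡ n
    leaves {e} p q with m≤n⇒m<n∨m≡n (v<n e)
    ... | inj₂ eq = eq
    ... | inj₁ lt = contradiction (∈A′⁺ (<-trans (n<1+n _) (subst (_< k) (m<n⇒m%n≡m lt) (∈A⁻ p)))) q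

    enters : ∀ {e} → e ∈ A′ → e ∉ A → suc (v e) ≡ k
    enters {e} p q with m≤n⇒m<n∨m≡n (∈A′⁻ p)
    ... | inj₂ eq = eq
    ... | inj₁ lt = contradiction (∈A⁺ (subst (_< k) (sym (m<n⇒m%n≡m (<-trans lt k<n))) lt)) q

  exit : ∃[ x ] ∃[ y ] Exit x y
  exit = let j , out , in′ = Cyc.Tight.entry w∈ 0<r 0<k (ekr-tight tight w∈) in exit-at j out in′
    where w∈ = ∈-order {n} Data.Fin.Permutation.id

  -- A single exit, found in the identity order, fixes the centre for all orders. That no other set
  -- of size `k` is a member follows afterwards by counting.
  star : ∃[ x ] (∀ {B} → ∣ B ∣ ≡ k → x ∈ B → φ B ≡ 1)
  star = proj₁ exit , λ {B} ∣B∣ x∈B → split ∣B∣ x∈B (_ ∈? B)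
    where
    split : ∀ {B} → ∣ B ∣ ≡ k → proj₁ exit ∈ B → Dec (proj₁ (proj₂ exit) ∈ B) → φ B ≡ 1
    split ∣B∣ x∈B (yes p) = containing-y (proj₂ (proj₂ exit)) ∣B∣ x∈B p
    split ∣B∣ x∈B (no p)  = avoiding-y (proj₂ (proj₂ exit)) ∣B∣ x∈B p

-- Levels, stars and isomorphism

∣∪∣≤ : ∀ {n} (A B : Subset n) → ∣ A ∪ B ∣ ≤ ∣ A ∣ + ∣ B ∣
∣∪∣≤ []            []            = z≤n
∣∪∣≤ (inside ∷ A)  (inside ∷ B)  = s≤s (≤-trans (∣∪∣≤ A B) (+-monoʳ-≤ ∣ A ∣ (n≤1+n ∣ B ∣)))
∣∪∣≤ (inside ∷ A)  (outside ∷ B) = s≤s (∣∪∣≤ A B)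
∣∪∣≤ (outside ∷ A) (inside ∷ B)  = ≤-trans (s≤s (∣∪∣≤ A B)) (≤-reflexive (sym (+-suc ∣ A ∣ ∣ B ∣)))
∣∪∣≤ (outside ∷ A) (outside ∷ B) = ∣∪∣≤ A B

size-1 : ∀ {n} {A : Subset n} {x y} → ∣ A ∣ ≡ 1 → x ∈ A → y ∈ A → x ≡ y
size-1 {A = A} {x} {y} e p q with x Fin.≟ y
... | yes eq = eq
... | no x≢y = contradiction (p⊂q⇒∣p∣<∣q∣ {p = ⁅ x ⁆} {q = A}
  ((λ z → subst (_∈ A) (sym (x∈⁅y⁆⇒x≡y x z)) p) , y , q , λ z → x≢y (sym (x∈⁅y⁆⇒x≡y x z))))
  (subst₂ (λ a b → ¬ a < b) (sym (∣⁅x⁆∣≡1 x)) (sym e) (<-irrefl refl))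

total-positive : ∀ (xs : List α) f → total xs f ≢ 0 → ∃[ x ] f x ≢ 0
total-positive []       f h = contradiction refl h
total-positive (x ∷ xs) f h with f x ≟ 0
... | yes e = total-positive xs f λ e′ → h (cong₂ _+_ e e′)
... | no ¬e = x , ¬e

star : Fin n → Subset n → ℕ
star x A = ind (x ∈? A)

level-star : ∀ {n} (x : Fin n) i → level n (star x) (suc i) ≡ (n ∸ 1) C i
level-star {suc m} x i = count-star m x i

C-absorb′ : ∀ n k .{{_ : NonZero n}} .{{_ : NonZero k}} → k * (n C k) ≡ n * ((n ∸ 1) C (k ∸ 1))
C-absorb′ (suc m) (suc i) = C-absorb m i

module _ {n : ℕ} {φ ψ : Subset n → ℕ} (i : ℕ) where

  level-cong : (∀ {A} → ∣ A ∣ ≡ i → φ A ≡ ψ A) → level n φ i ≡ level n ψ i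
  level-cong h = total-cong (subsets n) λ {A} _ → ind-*-cong (size? i A) h

  -- This turns counts back into membership: comparison with 0, 1 or a star identifies an empty
  -- level, a full level or a star.
  level-tight : (∀ {A} → ∣ A ∣ ≡ i → φ A ≤ ψ A) → level n φ i ≡ level n ψ i →
                ∀ {A} → ∣ A ∣ ≡ i → φ A ≡ ψ A
  level-tight h eq {A} e = begin
    φ A                    ≡⟨ unit φ ⟨
    ind (size? i A) * φ A  ≡⟨ total-tight (subsets n) (λ {A} _ → ind-*-mono (size? i A) h) eq (∈-subsets A) ⟩
    ind (size? i A) * ψ A  ≡⟨ unit ψ ⟩
    ψ A                    ∎
    where
    open ≡-Reasoning
    unit : ∀ χ → ind (size? i A) * χ A ≡ χ A
    unit χ = trans (cong (_* χ A) (ind-yes (size? i A) e)) (*-identityˡ (χ A))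

level-const : ∀ n c i → level n (λ _ → c) i ≡ c * (n C i)
level-const n c i = begin
  total (subsets n) (λ A → ind (size? i A) * c) ≡⟨ total-cong (subsets n) (λ {A} _ → *-comm _ c) ⟩
  total (subsets n) (λ A → c * ind (size? i A)) ≡⟨ total-*ˡ (subsets n) c _ ⟩
  c * total (subsets n) (λ A → ind (size? i A)) ≡⟨ cong (c *_) (count-level n i) ⟩
  c * (n C i) ∎
  where open ≡-Reasoning

-- Up to isomorphism the centre of a star is arbitrary.
module _ {n : ℕ} .{{_ : NonZero n}} (T : ℕ → Set → Set) (T-map : ∀ {i P Q} → (P → Q) → T i P → T i Q)
         (𝓕 : Pred (Subset n) 0ℓ) where

  private
    transport : ∀ {i j P Q} → i ≡ j → (P → Q) → T i P → T j Q
    transport refl = T-map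

  -- `T` sees a set only through its size and through whether it contains the centre, so a
  -- permutation does no more than move the centre.
  ≅⇒centre : 𝓕 ≅ (λ A → T ∣ A ∣ (first n ∈ A)) → ∃[ x ] 𝓕 ≐ (λ A → T ∣ A ∣ (x ∈ A))
  ≅⇒centre (π , to , from) = π ⟨$⟩ˡ first n ,
    (λ {A} p → transport (∣image∣ π A) (∈-image⁻ π {A} {first n}) (to p)) ,
    (λ {A} t → from (transport (sym (∣image∣ π A)) (∈-image⁺ π {A} {first n}) t))

  centre⇒≅ : ∀ x → 𝓕 ≐ (λ A → T ∣ A ∣ (x ∈ A)) → 𝓕 ≅ (λ A → T ∣ A ∣ (first n ∈ A))
  centre⇒≅ x (to , from) = π ,
    (λ {A} p → transport (sym (∣image∣ π A)) (∈-image⁺ π {A} {first n} ∘ subst (_∈ A) (sym π⁻¹)) (to p)) ,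
    (λ {A} t → from (transport (∣image∣ π A) (subst (_∈ A) π⁻¹ ∘ ∈-image⁻ π {A} {first n}) t))
    where
    π = transpose x (first n)
    π⁻¹ : π ⟨$⟩ˡ first n ≡ x
    π⁻¹ = transpose-left (first n) x

-- The bounds for a family

module Main {n s u : ℕ} .{{_ : NonZero n}} (s≤n : s ≤ n) (F : Family n)
            (F≤u : ⟦ F ⟧ ⊆ (λ A → ∣ A ∣ ≤ u)) (ci : ConditionallyIntersecting s F) where

  open Family F

  member? : ∀ A → Dec (A ∈ˡ members)
  member? A = DecMembership._∈?_ _≟ˢ_ A members

  φ : Subset n → ℕ
  φ A = ind (member? A)

  φ≤1 : ∀ A → φ A ≤ 1
  φ≤1 A = ind≤1 (member? A)

  φ≡1 : ∀ {A} → ⟦ F ⟧ A → φ A ≡ 1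
  φ≡1 {A} = ind-yes (member? A)

  φ≡0 : ∀ {A} → ¬ ⟦ F ⟧ A → φ A ≡ 0
  φ≡0 {A} = ind-no (member? A)

  member : ∀ {A} → φ A ≡ 1 → ⟦ F ⟧ A
  member {A} = ind⁻ (member? A)

  spread : ∀ {A B} → ∣ A ∣ + ∣ B ∣ ≤ s → (∀ {e} → e ∈ A → e ∉ B) → φ A + φ B ≤ 1
  spread {A} {B} le disjoint = lemma (member? A) (member? B)
    where
    lemma : (a : Dec (A ∈ˡ members)) (b : Dec (B ∈ˡ members)) → ind a + ind b ≤ 1
    lemma (yes a) (yes b) = let e , p = ci a b (≤-trans (∣∪∣≤ A B) le) ; e∈A , e∈B = x∈p∩q⁻ A B p in
      contradiction e∈B (disjoint e∈A)
    lemma (yes _) (no _)  = ≤-refl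
    lemma (no _)  b       = ind≤1 b

  open Spread s≤n φ φ≤1 spread

  f c : ℕ → ℕ
  f = level n φ
  c = n C_

  f≤c : ∀ i → f i ≤ c i
  f≤c = level≤C φ≤1

  -- The empty set is disjoint from itself, so `spread` applied to it twice gives 2 φ(∅) ≤ 1.
  f0 : f 0 ≡ 0
  f0 = trans (level-cong {φ = φ} {ψ = λ _ → 0} 0 λ {A} e → n≤0⇒n≡0 (+-cancelˡ-≤ (φ A) _ _ (lemma A e)))
    (level-const n 0 0)
    where
    lemma : ∀ A → ∣ A ∣ ≡ 0 → φ A + φ A ≤ φ A + 0
    lemma A e = ≤-trans (double (φ≤1 A) (spread (subst (_≤ s) (sym (cong₂ _+_ e e)) z≤n) (λ p → contradiction p (size-0 A e)))) (m≤m+n (φ A) 0)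
      where
      double : ∀ {z} → z ≤ 1 → z + z ≤ 1 → z + z ≤ z
      double {zero}  _ _ = z≤n
      double {suc zero} _ (s≤s ())
      double {suc (suc _)} (s≤s ()) _

  card≡ : card F ≡ range (suc u) f
  card≡ = begin
    length members                    ≡⟨ *-identityʳ _ ⟨
    length members * 1                ≡⟨ total-const members 1 ⟨
    total members (λ _ → 1)
      ≡⟨ total-cong members (λ {B} _ → trans (total-single {f = λ A → ind (B ≟ˢ A)} (subsets-unique n) (∈-subsets B)
           (λ {A} A≢B → ind-no (B ≟ˢ A) (A≢B ∘ sym))) (ind-yes (B ≟ˢ B) refl)) ⟨
    total members (λ B → total (subsets n) (λ A → ind (B ≟ˢ A))) ≡⟨ total-swap members (subsets n) _ ⟩
    total (subsets n) (λ A → total members (λ B → ind (B ≟ˢ A))) ≡⟨ total-cong (subsets n) (λ {A} _ → multiplicity A (member? A)) ⟩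
    total (subsets n) φ               ≡⟨ total-cong (subsets n) (λ {A} _ → sizes A (member? A)) ⟨
    total (subsets n) (λ A → total (upTo (suc u)) (λ i → ind (size? i A) * φ A)) ≡⟨ total-swap (subsets n) (upTo (suc u)) _ ⟩
    total (upTo (suc u)) f            ≡⟨ range≡total (suc u) f ⟨
    range (suc u) f                   ∎
    where
    open ≡-Reasoning
    multiplicity : ∀ A (d : Dec (A ∈ˡ members)) → total members (λ B → ind (B ≟ˢ A)) ≡ ind d
    multiplicity A (yes A∈) = trans (total-single {f = λ B → ind (B ≟ˢ A)} unique A∈ (λ {B} B≢A → ind-no (B ≟ˢ A) B≢A)) (ind-yes (A ≟ˢ A) refl)
    multiplicity A (no A∉)  = total-0 members (λ {B} B∈ → ind-no (B ≟ˢ A) (λ eq → A∉ (subst (_∈ˡ members) eq B∈)))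

    sizes : ∀ A (d : Dec (A ∈ˡ members)) → total (upTo (suc u)) (λ i → ind (size? i A) * ind d) ≡ ind d
    sizes A (yes A∈) = trans (total-single {f = λ i → ind (size? i A) * 1} (Unique.upTo⁺ (suc u)) (∈-upTo⁺ (s≤s (F≤u A∈)))
      (λ {i} i≢ → cong (_* 1) (ind-no (size? i A) (i≢ ∘ sym)))) (cong (_* 1) (ind-yes (size? ∣ A ∣ A) refl))
    sizes A (no _) = total-0 (upTo (suc u)) (λ {i} _ → *-zeroʳ (ind (size? i A)))

  empty-level : ∀ {i} → f i ≡ 0 → ∀ {A} → ∣ A ∣ ≡ i → ¬ ⟦ F ⟧ A
  empty-level {i} eq e A∈ = contradiction
    (trans (level-tight {φ = λ _ → 0} {ψ = φ} i (λ _ → z≤n) (trans (level-const n 0 i) (sym eq)) e) (φ≡1 A∈)) λ ()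

  full-level : ∀ {i} → f i ≡ c i → ∀ {A} → ∣ A ∣ ≡ i → ⟦ F ⟧ A
  full-level {i} eq e = member (level-tight {φ = φ} {ψ = λ _ → 1} i (λ _ → φ≤1 _)
    (trans eq (sym (trans (level-const n 1 i) (*-identityˡ _)))) e)

  empty-level⁻ : ∀ {i} → (∀ {A} → ∣ A ∣ ≡ i → ¬ ⟦ F ⟧ A) → f i ≡ 0
  empty-level⁻ {i} h = trans (level-cong {φ = φ} {ψ = λ _ → 0} i (φ≡0 ∘ h)) (level-const n 0 i)

  full-level⁻ : ∀ {i} → (∀ {A} → ∣ A ∣ ≡ i → ⟦ F ⟧ A) → f i ≡ c i
  full-level⁻ {i} h = trans (level-cong {φ = φ} {ψ = λ _ → 1} i (φ≡1 ∘ h)) (trans (level-const n 1 i) (*-identityˡ _))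

  star-level⁻ : ∀ {i x} → (∀ {A} → ∣ A ∣ ≡ suc i → ⟦ F ⟧ A ⇔ x ∈ A) → f (suc i) ≡ (n ∸ 1) C i
  star-level⁻ {i} {x} h = trans (level-cong {φ = φ} {ψ = star x} (suc i)
    (λ {A} e → ind-⇔ (member? A) (x ∈? A) (Equivalence.to (h e)) (Equivalence.from (h e)))) (level-star x i)

  module _ {i : ℕ} (2k≤s : suc i + suc i ≤ s) where

    private
      k = suc i
      r = n ∸ (k + k)
      n≡ : n ≡ k + (r + k)
      n≡ = trans (sym (m+[n∸m]≡n (≤-trans 2k≤s s≤n))) (trans (+-assoc k k r) (cong (k +_) (+-comm k r)))

    ekr-bound : f k ≤ (n ∸ 1) C i
    ekr-bound = *-cancelˡ-≤ n (subst (n * f k ≤_) (C-absorb′ n k) (EKR.ekr {k} {r} n≡ 2k≤s))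

    -- From s < n comes 2k < n. The level contains a full star and has exactly its size, so it is
    -- that star.
    ekr-star : s < n → f k ≡ (n ∸ 1) C i → ∃[ x ] (∀ {A} → ∣ A ∣ ≡ k → ⟦ F ⟧ A ⇔ x ∈ A)
    ekr-star s<n eq = x , λ {A} e → mk⇔
      (λ A∈ → ind⁻ (x ∈? A) (trans (same e) (φ≡1 A∈)))
      (λ x∈ → member (contained e x∈))
      where
      unique-star = Uniqueness.star s≤n φ φ≤1 spread {k} {r} n≡ 2k≤s (s≤s z≤n) (m<n⇒0<n∸m (≤-<-trans 2k≤s s<n))
        (trans (cong (n *_) eq) (sym (C-absorb′ n k)))
      x = proj₁ unique-star
      contained : ∀ {A} → ∣ A ∣ ≡ k → x ∈ A → φ A ≡ 1
      contained = proj₂ unique-star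
      below : ∀ {A} → ∣ A ∣ ≡ k → (d : Dec (x ∈ A)) → ind d ≤ φ A
      below e (yes p) = ≤-reflexive (sym (contained e p))
      below e (no _)  = z≤n
      same : ∀ {A} → ∣ A ∣ ≡ k → star x A ≡ φ A
      same = level-tight {φ = star x} {ψ = φ} k (λ {A} e → below e (x ∈? A)) (trans (level-star x i) (sym eq))

  -- The levels 1, …, m are matched with the levels h + m − 1, …, h; the g levels
  -- between them are left over, as are those from h + m on.
  module Matching {h : ℕ} (m g q : ℕ) (h≡ : h ≡ suc m + g) (s≡ : s ≡ h + m) (u≡ : suc u ≡ h + m + q) where

    middle outer : ℕ
    middle = range g (λ i → f (suc m + i))
    outer  = range m (f ∘ suc) + range (m + q) (λ i → f (h + i))

    private
      lower upper : ℕ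
      lower  = range m (f ∘ suc)
      upper  = range (m + q) (λ i → f (h + i))

      -- The partner s - (i + 1) of level i + 1, written as an index counted down from h + m - 1 so
      -- that `range-reverse` applies.
      partner : ℕ → ℕ
      partner i = h + (m ∸ suc i)

      pair-sum : ∀ {i} → i < m → suc i + partner i ≡ s
      pair-sum {i} i<m = begin
        suc i + (h + (m ∸ suc i)) ≡⟨ swap (suc i) h (m ∸ suc i) ⟩
        h + (suc i + (m ∸ suc i)) ≡⟨ cong (h +_) (m+[n∸m]≡n i<m) ⟩
        h + m                     ≡⟨ s≡ ⟨
        s                         ∎
        where
        open ≡-Reasoning
        swap : ∀ a b c → a + (b + c) ≡ b + (a + c)
        swap = solve-∀

      pair-< : ∀ {i} → i < m → suc i < partner i
      pair-< i<m = <-≤-trans (s≤s i<m) (≤-trans (subst (suc m ≤_) (sym h≡) (m≤m+n (suc m) g)) (m≤m+n h _))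

      pair≤ : ∀ {i} → i < m → f (suc i) + f (partner i) ≤ c (partner i)
      pair≤ i<m = pair-bound (pair-< i<m) (≤-reflexive (pair-sum i<m))

      paired : lower + range m (λ i → f (h + i)) ≡ range m (λ i → f (suc i) + f (partner i))
      paired = trans (cong (lower +_) (sym (range-reverse m (λ i → f (h + i))))) (sym (range-+ m (f ∘ suc) (f ∘ partner)))

      paired-C : range m (λ i → c (h + i)) ≡ range m (c ∘ partner)
      paired-C = sym (range-reverse m (λ i → c (h + i)))

      lower+upper : lower + upper ≡ range m (λ i → f (suc i) + f (partner i)) + range q (λ i → f (h + (m + i)))
      lower+upper = begin
        lower + upper ≡⟨ cong (lower +_) (range-split m q (λ i → f (h + i))) ⟩
        lower + (range m (λ i → f (h + i)) + range q (λ i → f (h + (m + i)))) ≡⟨ +-assoc lower _ _ ⟨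
        lower + range m (λ i → f (h + i)) + range q (λ i → f (h + (m + i))) ≡⟨ cong (_+ range q (λ i → f (h + (m + i)))) paired ⟩
        range m (λ i → f (suc i) + f (partner i)) + range q (λ i → f (h + (m + i))) ∎
        where open ≡-Reasoning

      all-C : range (m + q) (λ i → c (h + i)) ≡ range m (c ∘ partner) + range q (λ i → c (h + (m + i)))
      all-C = trans (range-split m q (λ i → c (h + i))) (cong (_+ range q (λ i → c (h + (m + i)))) paired-C)

    card-split : card F ≡ middle + outer
    card-split = begin
      card F                                ≡⟨ card≡ ⟩
      range (suc u) f                       ≡⟨ cong (λ l → range l f) u≡ ⟩
      range (h + m + q) f                   ≡⟨ cong (λ l → range l f) (+-assoc h m q) ⟩
      range (h + (m + q)) f                 ≡⟨ range-split h (m + q) f ⟩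
      range h f + upper                     ≡⟨ cong (λ l → range l f + upper) h≡ ⟩
      range (suc m + g) f + upper           ≡⟨ cong (_+ upper) (range-split (suc m) g f) ⟩
      f 0 + lower + middle + upper          ≡⟨ cong (λ z → z + lower + middle + upper) f0 ⟩
      lower + middle + upper                ≡⟨ swap lower middle upper ⟩
      middle + (lower + upper)              ∎
      where
      open ≡-Reasoning
      swap : ∀ a b c → a + b + c ≡ b + (a + c)
      swap = solve-∀

    high-sum : ∑[ i ∈ h ⋯ u ] (n C i) ≡ range (m + q) (λ i → c (h + i))
    high-sum = cong (λ l → range l (λ i → c (h + i)))
      (trans (cong (_∸ h) (trans u≡ (+-assoc h m q))) (m+n∸m≡n h (m + q)))

    private
      tail≤ : range q (λ i → f (h + (m + i))) ≤ range q (λ i → c (h + (m + i)))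
      tail≤ = range-mono q (λ _ → f≤c _)

    outer≤ : outer ≤ ∑[ i ∈ h ⋯ u ] (n C i)
    outer≤ = begin
      lower + upper ≡⟨ lower+upper ⟩
      range m (λ i → f (suc i) + f (partner i)) + range q (λ i → f (h + (m + i))) ≤⟨ +-mono-≤ (range-mono m pair≤) tail≤ ⟩
      range m (c ∘ partner) + range q (λ i → c (h + (m + i))) ≡⟨ all-C ⟨
      range (m + q) (λ i → c (h + i)) ≡⟨ high-sum ⟨
      ∑[ i ∈ h ⋯ u ] (n C i) ∎
      where open ≤-Reasoning

    module _ (s<n : s < n) (tight : outer ≡ ∑[ i ∈ h ⋯ u ] (n C i)) where

      private
        both = ≤-sum-tight (range-mono m pair≤) tail≤ (trans (sym lower+upper) (trans tight (trans high-sum all-C)))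

        pairs : ∀ {i} → i < m → f (suc i) ≡ 0 × f (partner i) ≡ c (partner i)
        pairs i<m = pair-tight (pair-< i<m) (≤-reflexive (pair-sum i<m)) s<n (range-tight m pair≤ (proj₁ both) i<m)

      low-empty : ∀ {i} → i < suc m → f i ≡ 0
      low-empty {zero}  _         = f0
      low-empty {suc i} (s≤s i<m) = proj₁ (pairs i<m)

      high-full : ∀ {i} → h ≤ i → i ≤ u → f i ≡ c i
      high-full {i} h≤i i≤u with i ∸ h | m+[n∸m]≡n h≤i
      ... | d | refl with <-≤-connex d m
      -- Level h + d is the partner of level m - d, whose index is m - (d + 1).
      ...   | inj₁ d<m = subst (λ z → f (h + z) ≡ c (h + z)) back (proj₂ (pairs {m ∸ suc d} (∸-monoʳ-< z<s d<m)))
        where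
        back : m ∸ suc (m ∸ suc d) ≡ d
        back = trans (cong (m ∸_) (trans (sym (+-∸-assoc 1 d<m)) refl)) (m∸[m∸n]≡n (<⇒≤ d<m))
      ...   | inj₂ m≤d with d ∸ m | m+[n∸m]≡n m≤d
      ...     | t | refl = range-tight q (λ _ → f≤c _) (proj₂ both)
        (+-cancelˡ-< (h + m) t q (subst₂ _<_ (sym (+-assoc h m t)) u≡ (s≤s i≤u)))

    outer-tight⁻ : (∀ {i} → i < suc m → f i ≡ 0) → (∀ {i} → h ≤ i → i ≤ u → f i ≡ c i) →
             outer ≡ ∑[ i ∈ h ⋯ u ] (n C i)
    outer-tight⁻ low high = begin
      lower + upper ≡⟨ cong (_+ upper) (trans (range-cong m (λ i<m → low (s≤s i<m))) (trans (range-const m 0) (*-zeroʳ m))) ⟩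
      upper         ≡⟨ range-cong (m + q) (λ {i} lt → high (m≤m+n h i) (s≤s⁻¹ (subst (h + i <_) (sym (trans u≡ (+-assoc h m q))) (+-monoʳ-< h lt)))) ⟩
      range (m + q) (λ i → c (h + i)) ≡⟨ high-sum ⟨
      ∑[ i ∈ h ⋯ u ] (n C i) ∎
      where open ≡-Reasoning

  -- The partner of level 1 is s - 1 ≤ u, so all partners lie in range, and the `q` levels from `s`
  -- to `u` remain without one.
  module _ (s≤1+u : s ≤ suc u) where

    private
      q = suc u ∸ s

      u≡ : ∀ {h m} → s ≡ h + m → suc u ≡ h + m + q
      u≡ s≡ = trans (sym (m+[n∸m]≡n s≤1+u)) (cong (_+ q) s≡)

    -- Here k = m + 1, and the levels 1, ..., m are paired with m + 1, ..., 2m, leaving no level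
    -- between.
    module Odd {m} (s≡ : s ≡ suc m + m) where

      open Matching {suc m} m 0 q (sym (+-identityʳ (suc m))) s≡ (u≡ {suc m} {m} s≡)

      bound : ℕ
      bound = ∑[ i ∈ suc m ⋯ u ] (n C i)

      odd-≤ : card F ≤ bound
      odd-≤ = subst (_≤ bound) (sym card-split) outer≤

      odd-⇔ : s < n → card F ≡ bound ⇔ ⟦ F ⟧ ≐ (λ A → suc m ≤ ∣ A ∣ × ∣ A ∣ ≤ u)
      odd-⇔ s<n = mk⇔
        (λ eq → let tight = trans (sym card-split) eq in
          (λ {A} A∈ → ≮⇒≥ (λ lt → empty-level (low-empty s<n tight lt) refl A∈) , F≤u A∈) ,
          (λ {A} (le , le′) → full-level (high-full s<n tight le le′) refl))
        (λ (to , from) → trans card-split (outer-tight⁻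
          (λ lt → empty-level⁻ (λ e A∈ → <⇒≱ lt (subst (suc m ≤_) e (proj₁ (to A∈)))))
          (λ le le′ → full-level⁻ (λ e → from (subst (suc m ≤_) (sym e) le , subst (_≤ u) (sym e) le′)))))

    -- Here k = m + 1, and the levels 1, ..., m are paired with m + 2, ..., 2m + 1. Level `k` would
    -- be its own partner and is left to the Erdős-Ko-Rado bound.
    module Even {m} (s≡ : s ≡ suc m + 1 + m) where

      private
        k = suc m

        2k≤s : k + k ≤ s
        2k≤s = ≤-reflexive (trans (sym (+-assoc k 1 m)) (sym s≡))

        shift : ∀ {i} → k < i → k + 1 ≤ i
        shift {i} = subst (_≤ i) (+-comm 1 k)

        unshift : ∀ {i} → k + 1 ≤ i → k < i
        unshift {i} = subst (_≤ i) (+-comm k 1)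

        T : ℕ → Set → Set
        T i P = (k < i × i ≤ u) ⊎ (i ≡ k × P)

        T-map : ∀ {i P Q} → (P → Q) → T i P → T i Q
        T-map g = Sum.map₂ (Product.map₂ g)

      open Matching {k + 1} m 1 q refl s≡ (u≡ {k + 1} {m} s≡)

      bound : ℕ
      bound = ((n ∸ 1) C m) + (∑[ i ∈ (k + 1) ⋯ u ] (n C i))

      private
        middle≡ : middle ≡ f k
        middle≡ = trans (+-identityʳ _) (cong f (+-identityʳ k))

        middle≤ : middle ≤ (n ∸ 1) C m
        middle≤ = subst (_≤ (n ∸ 1) C m) (sym middle≡) (ekr-bound 2k≤s)

      even-≤ : card F ≤ bound
      even-≤ = subst (_≤ bound) (sym card-split) (+-mono-≤ middle≤ outer≤)

      even-⇔ : s < n → card F ≡ bound ⇔ ⟦ F ⟧ ≅ (λ A → T ∣ A ∣ (first n ∈ A))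
      even-⇔ s<n = mk⇔ (λ eq → extremal (≤-sum-tight middle≤ outer≤ (trans (sym card-split) eq)))
                       (λ iso → attained (≅⇒centre T T-map ⟦ F ⟧ iso))
        where
        extremal : middle ≡ (n ∸ 1) C m × outer ≡ ∑[ i ∈ (k + 1) ⋯ u ] (n C i) → ⟦ F ⟧ ≅ (λ A → T ∣ A ∣ (first n ∈ A))
        extremal (mid , out) = centre⇒≅ T T-map ⟦ F ⟧ x ((λ {A} → to A (<-cmp ∣ A ∣ k)) , from)
          where
          centre = ekr-star 2k≤s s<n (trans (sym middle≡) mid)
          x = proj₁ centre
          to : ∀ A → Tri (∣ A ∣ < k) (∣ A ∣ ≡ k) (∣ A ∣ > k) → ⟦ F ⟧ A → T ∣ A ∣ (x ∈ A)
          to A (tri< lt _ _) A∈ = contradiction A∈ (empty-level (low-empty s<n out lt) refl)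
          to A (tri≈ _ e _)  A∈ = inj₂ (e , Equivalence.to (proj₂ centre e) A∈)
          to A (tri> _ _ gt) A∈ = inj₁ (gt , F≤u A∈)
          from : ∀ {A} → T ∣ A ∣ (x ∈ A) → ⟦ F ⟧ A
          from (inj₁ (gt , le)) = full-level (high-full s<n out (shift gt) le) refl
          from (inj₂ (e , x∈A)) = Equivalence.from (proj₂ centre e) x∈A

        attained : ∃[ x ] ⟦ F ⟧ ≐ (λ A → T ∣ A ∣ (x ∈ A)) → card F ≡ bound
        attained (x , to , from) = trans card-split (cong₂ _+_
          (trans middle≡ (star-level⁻ {x = x} (λ e → mk⇔ (at-k e ∘ to) (λ x∈A → from (inj₂ (e , x∈A))))))
          (outer-tight⁻
            (λ lt → empty-level⁻ (λ e A∈ → too-small (subst (_< k) (sym e) lt) (to A∈)))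
            (λ le le′ → full-level⁻ (λ e → from (inj₁ (unshift (subst (k + 1 ≤_) (sym e) le) , subst (_≤ u) (sym e) le′))))))
          where
          at-k : ∀ {A : Subset n} → ∣ A ∣ ≡ k → T ∣ A ∣ (x ∈ A) → x ∈ A
          at-k e (inj₁ (gt , _)) = contradiction (sym e) (<⇒≢ gt)
          at-k e (inj₂ (_ , p))  = p
          too-small : ∀ {i P} → i < k → ¬ T i P
          too-small lt (inj₁ (gt , _)) = <-asym lt gt
          too-small lt (inj₂ (e , _))  = <⇒≢ lt e

  module Small .{{_ : NonZero u}} (u+u≤s : u + u ≤ s) where

    bound : ℕ
    bound = ∑[ r ∈ 1 ⋯ u ] ((n ∸ 1) C (r ∸ 1))

    private
      0<u : 0 < u
      0<u = >-nonZero⁻¹ u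

      card≡positive : card F ≡ range u (f ∘ suc)
      card≡positive = trans card≡ (cong (_+ range u (f ∘ suc)) f0)

      levels≤ : ∀ {i} → i < u → f (suc i) ≤ (n ∸ 1) C i
      levels≤ i<u = ekr-bound (≤-trans (+-mono-≤ i<u i<u) u+u≤s)

      T : ℕ → Set → Set
      T i P = (1 ≤ i × i ≤ u) × P

      T-map : ∀ {i P Q} → (P → Q) → T i P → T i Q
      T-map g = Product.map₂ g

    small-≤ : card F ≤ bound
    small-≤ = subst (_≤ bound) (sym card≡positive) (range-mono u levels≤)

    small-⇔ : card F ≡ bound ⇔ ⟦ F ⟧ ≅ (λ A → T ∣ A ∣ (first n ∈ A))
    small-⇔ = mk⇔ (λ eq → extremal (range-tight u levels≤ (trans (sym card≡positive) eq)))
                  (λ iso → attained (≅⇒centre T T-map ⟦ F ⟧ iso))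
      where
      attained : ∃[ x ] ⟦ F ⟧ ≐ (λ A → T ∣ A ∣ (x ∈ A)) → card F ≡ bound
      attained (x , to , from) = trans card≡positive (range-cong u (λ i<u → star-level⁻ {x = x} (λ e → mk⇔
        (proj₂ ∘ to) (λ x∈A → from ((subst (1 ≤_) (sym e) (s≤s z≤n) , subst (_≤ u) (sym e) i<u) , x∈A)))))

      extremal : (∀ {i} → i < u → f (suc i) ≡ (n ∸ 1) C i) → ⟦ F ⟧ ≅ (λ A → T ∣ A ∣ (first n ∈ A))
      extremal levels = centre⇒≅ T T-map ⟦ F ⟧ x (to , from)
        where
        -- Since u ≥ 1, level 1 is among the attained ones, and its bound is C(n-1,0) = 1.
        f1≢0 : f 1 ≢ 0
        f1≢0 e = contradiction (trans (sym (levels 0<u)) e) λ ()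

        witness = total-positive (subsets n) (λ A → ind (size? 1 A) * φ A) f1≢0
        S = proj₁ witness

        ∣S∣≡1 : ∣ S ∣ ≡ 1
        ∣S∣≡1 = decidable-stable (size? 1 S) λ ≢1 → proj₂ witness (cong (_* φ S) (ind-no (size? 1 S) ≢1))

        S∈F : ⟦ F ⟧ S
        S∈F = decidable-stable (member? S) λ S∉ → proj₂ witness (trans (cong (ind (size? 1 S) *_) (φ≡0 S∉)) (*-zeroʳ (ind (size? 1 S))))

        ∪-small : ∀ {A} → ⟦ F ⟧ A → ∣ S ∪ A ∣ ≤ s
        ∪-small {A} A∈ = begin
          ∣ S ∪ A ∣     ≤⟨ ∣∪∣≤ S A ⟩
          ∣ S ∣ + ∣ A ∣ ≤⟨ +-mono-≤ (subst (_≤ u) (sym ∣S∣≡1) 0<u) (F≤u A∈) ⟩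
          u + u         ≤⟨ u+u≤s ⟩
          s             ∎
          where open ≤-Reasoning

        x : Fin n
        x = proj₁ (ci S∈F S∈F (∪-small S∈F))

        x∈S : x ∈ S
        x∈S = proj₁ (x∈p∩q⁻ S S (proj₂ (ci S∈F S∈F (∪-small S∈F))))

        x∈ : ∀ {A} → ⟦ F ⟧ A → x ∈ A
        x∈ {A} A∈ = let e , p = ci S∈F A∈ (∪-small A∈) ; e∈S , e∈A = x∈p∩q⁻ S A p in
          subst (_∈ A) (size-1 ∣S∣≡1 e∈S x∈S) e∈A

        positive : ∀ {A} → ⟦ F ⟧ A → 1 ≤ ∣ A ∣
        positive A∈ = n≢0⇒n>0 (λ e → size-0 _ e (x∈ A∈))

        to : ∀ {A} → ⟦ F ⟧ A → T ∣ A ∣ (x ∈ A)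
        to A∈ = (positive A∈ , F≤u A∈) , x∈ A∈

        below : ∀ {A} (d : Dec (A ∈ˡ members)) → ind d ≤ star x A
        below {A} (yes A∈) = ≤-reflexive (sym (ind-yes (x ∈? A) (x∈ A∈)))
        below     (no _)   = z≤n

        full : ∀ {A} i → ∣ A ∣ ≡ suc i → i < u → x ∈ A → ⟦ F ⟧ A
        full {A} i e i<u x∈A = member (trans
          (level-tight {φ = φ} {ψ = star x} (suc i) (λ {A} _ → below (member? A)) (trans (levels i<u) (sym (level-star x i))) e)
          (ind-yes (x ∈? A) x∈A))

        from : ∀ {A} → T ∣ A ∣ (x ∈ A) → ⟦ F ⟧ A
        from {A} ((1≤ , ≤u) , x∈A) = full (pred ∣ A ∣) eq (subst (_≤ u) eq ≤u) x∈A
          where eq = sym (suc-pred ∣ A ∣ {{>-nonZero 1≤}})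

theorem25 :
    (n s u : ℕ) .{{_ : NonZero n}} .{{_ : NonZero s}} .{{_ : NonZero u}} →
    s ≤ n →
    (F : Family n) →
    ⟦ F ⟧ ⊆ (λ A → ∣ A ∣ ≤ u) →
    ConditionallyIntersecting s F →
    (s ∸ 1 ≤ u → (k : ℕ) → s ≡ 2 * k →
      let bound = ((n ∸ 1) C (k ∸ 1)) + (∑[ i ∈ (k + 1) ⋯ u ] (n C i)) in
      card F ≤ bound
      × (s < n →
          card F ≡ bound
          ⇔ ⟦ F ⟧ ≅ (λ A → (k < ∣ A ∣ × ∣ A ∣ ≤ u) ⊎ (∣ A ∣ ≡ k × first n ∈ A))))
    × (s ∸ 1 ≤ u → (k : ℕ) → s ≡ 2 * k ∸ 1 →
      let bound = ∑[ i ∈ k ⋯ u ] (n C i) in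
      card F ≤ bound
      × (s < n →
          card F ≡ bound
          ⇔ ⟦ F ⟧ ≐ (λ A → k ≤ ∣ A ∣ × ∣ A ∣ ≤ u)))
    × (u ≤ ⌊ s /2⌋ →
      let bound = ∑[ r ∈ 1 ⋯ u ] ((n ∸ 1) C (r ∸ 1)) in
      card F ≤ bound
      × (card F ≡ bound
          ⇔ ⟦ F ⟧ ≅ (λ A → (1 ≤ ∣ A ∣ × ∣ A ∣ ≤ u) × first n ∈ A)))
theorem25 n s u s≤n F F≤u ci = even , odd , small
  where
  open Main s≤n F F≤u ci

  s≤1+u : s ∸ 1 ≤ u → s ≤ suc u
  s≤1+u le = ≤-trans (≤-reflexive (sym (suc-pred s))) (s≤s le)

  2*suc : ∀ m → 2 * suc m ≡ suc m + 1 + m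
  2*suc = solve-∀

  even : _
  even le zero    s≡ = contradiction s≡ (≢-nonZero⁻¹ s)
  even le (suc m) s≡ = even-≤ , even-⇔
    where open Even (s≤1+u le) {m} (trans s≡ (2*suc m))

  odd : _
  -- Truncated subtraction makes 2k - 1 equal to 0 at k = 0, against s > 0.
  odd le zero    s≡ = contradiction s≡ (≢-nonZero⁻¹ s)
  odd le (suc m) s≡ = odd-≤ , odd-⇔
    where
    2*suc∸1 : ∀ m → 2 * suc m ∸ 1 ≡ suc m + m
    2*suc∸1 m = trans (cong (m +_) (+-identityʳ (suc m))) (+-suc m m)
    open Odd (s≤1+u le) {m} (trans s≡ (2*suc∸1 m))

  small : _
  small u≤ = small-≤ , small-⇔
    where
    u+u≤s : u + u ≤ s
    u+u≤s = begin
      u + u                 ≤⟨ +-mono-≤ u≤ (≤-trans u≤ (⌊n/2⌋≤⌈n/2⌉ s)) ⟩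
      ⌊ s /2⌋ + ⌈ s /2⌉     ≡⟨ ⌊n/2⌋+⌈n/2⌉≡n s ⟩
      s                     ∎
      where open ≤-Reasoning
    open Small u+u≤s
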